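{- Let $X$ be a simplicial surface. Then $X$ is face-transitive with $\mathrm{vf}(X)=(1,2)$ if and only if $H:=\lambda_X(\mathrm{Aut}(X))$ is a $(1,2)$-group of the face graph $\mathcal F(X)$ and the cycle double cover $\mathcal C^{(1,2)}(H)$ (for a suitable choice of the data defining it) contains the vertex-defining cycles of $X$.
   Context: A simplicial complex $X$ on a finite non-empty set $P$ is a non-empty family of subsets of $P$ closed under taking subsets; $X_i$ is the set of its elements of cardinality $i+1$; elements of $X_0,X_1,X_2$ are vertices, edges, faces. A simplicial surface is a simplicial complex $X$ such that: all inclusion-maximal elements have cardinality $3$; every edge lies in exactly two faces; and for every vertex $v$ the faces containing $v$ can be arranged in a cyclic sequence $u(v)=(F_1,\dots,F_n)$ (each once), the umbrella of $v$, with $|F_i\cap F_{i+1}|=2$ (subscripts mod $n$). Simplicial surfaces are assumed strongly connected (any two faces joined by a sequence of faces with consecutive ones sharing an edge). $\mathrm{Aut}(X)$ is the automorphism group (permutations of $X_0$ mapping faces to faces). $X$ is face-transitive if $\mathrm{Aut}(X)$ is transitive on $X_2$; then $\mathrm{vf}(X)=(a,s)$ with $a$ the number of $\mathrm{Aut}(X)$-orbits on $X_0$ and $s$ the order of the stabiliser in $\mathrm{Aut}(X)$ of a face. All graphs are finite, simple, undirected, connected; their elements are called nodes and arcs. The face graph $\mathcal F(X)$ has node set $X_2$, two faces being joined by an arc iff they share an edge; it is cubic. $\lambda_X:\mathrm{Aut}(X)\to\mathrm{Aut}(\mathcal F(X))$ is the injective homomorphism sending an automorphism to the permutation it induces on $X_2$.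 Each umbrella $u(v)$ is a cycle in $\mathcal F(X)$, called a vertex-defining cycle of $X$. Cycles are considered up to rotation and reversal; for a subgroup $H$ of the automorphism group of a graph and a cycle $C$, $C^H$ denotes the $H$-orbit of $C$ under the induced action on cycles. A cycle double cover of a cubic graph is a set of cycles such that every arc lies in exactly two of them. It is vertex-faithful if all its cycles are chordless and any two distinct cycles share at most one arc. $\alpha$-cycles: let $\mathcal G=(V,E)$ be a cubic node-transitive graph (i.e. $\mathrm{Aut}(\mathcal G)$ is transitive on $V$), $F_1,\dots,F_n\in V$ with $\{F_i,F_{i+1}\}\in E$ for $1\le i\le n-1$, and $\sigma\in\mathrm{Aut}(\mathcal G)$ of order $\ell$ with $\sigma(F_1)=F_n$. Put $\Sigma=\{\sigma^i(F_j): 0\le i\le \ell-1,\ 1\le j\le n-1\}$. If $|\Sigma|=(n-1)\ell$, then $\alpha(\sigma,F_1,\dots,F_n)$ is the cycle $(\sigma(F_1),\dots,\sigma(F_{n-1}),\dots,\sigma^\ell(F_1),\dots,\sigma^\ell(F_{n-1}))$; otherwise it is the empty cycle. A subgroup $H\le\mathrm{Aut}(\mathcal G)$ is a $(1,2)$-group of $\mathcal G$ if: (1) $H$ acts transitively on $V$ with $|H|=2|V|$; (2) $E$ partitions into two $H$-orbits $E_1,E_2$ with $|E_1|=|V|$ and $|E_2|=\tfrac12|V|$; (3) there are $F_1,F_2,F_3,F_4\in V$ with $\{F_1,F_2\}\in E_2$ and $\{F_2,F_3\},\{F_3,F_4\}\in E_1$, and $\sigma\in\mathrm{Aut}(\mathcal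 G)$ with $\sigma(F_1)=F_4$, such that $\alpha(\sigma,F_1,F_2,F_3,F_4)^H$ is a vertex-faithful cycle double cover of $\mathcal G$. This cover is denoted $\mathcal C^{(1,2)}(H)$. -}

module Defs where

open import Algebra.Bundles using (Group)
import Algebra.Definitions.RawMonoid as RawMonoidDefs
open import Data.Bool using (Bool; true; false; T; if_then_else_)
import Data.Bool.Properties as Bool
open import Data.Fin.Subset using (Subset; _⊆_; _∩_; ∣_∣)
open import Data.List.Base
  using (List; []; _∷_; _++_; length; map; concatMap; upTo; take; reverse; deduplicate)
open import Data.List.Membership.Propositional using (_∈_)
open import Data.List.Membership.Propositional.Properties
  using (∈-++⁺ˡ; ∈-++⁺ʳ; ∈-map⁺; ∈-concatMap⁺; ∈-deduplicate⁺)
open import Data.List.Relation.Unary.All using (All)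
import Data.List.Relation.Unary.All as All
open import Data.List.Relation.Unary.AllPairs using (AllPairs)
open import Data.List.Relation.Unary.Any using (Any; here)
import Data.List.Relation.Unary.Any as Any
open import Data.List.Relation.Unary.Linked using (Linked)
open import Data.List.Relation.Unary.Unique.Propositional using (Unique)
open import Data.List.Relation.Unary.Unique.DecPropositional.Properties using (deduplicate-!)
open import Data.Nat using (ℕ; zero; suc; _*_; _≤_; _<_; NonZero)
import Data.Nat.Properties as ℕ
open import Data.Product using (Σ-syntax; ∃-syntax; _×_; _,_; proj₁; proj₂)
open import Data.Sum using (_⊎_)
open import Data.Unit using (tt)
open import Data.Vec.Base using (Vec; []; _∷_; toList; init)
import Data.Vec.Properties as Vec
open import Function.Base using (_∘_)
open import Function.Bundles using (_↔_; _⇔_; Inverse; Equivalence; mk⇔)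
open import Function.Construct.Composition using (_↔-∘_; _⇔-∘_)
open import Function.Construct.Identity using (↔-id; ⇔-id)
open import Function.Construct.Symmetry using (↔-sym)
open import Level using (0ℓ)
open import Relation.Binary using (Rel; DecidableEquality)
open import Relation.Binary.Construct.Closure.ReflexiveTransitive using (Star; ε; _◅_)
open import Relation.Binary.PropositionalEquality
  using (_≡_; _≢_; refl; sym; trans; cong; cong₂; subst₂)
open import Relation.Nullary using (¬_; does; yes; no)
open import Relation.Nullary.Decidable using (map′)
open import Relation.Unary using (Pred; U)

------------------------------------------------------------------------
-- Counting

-- P has exactly n elements when elements related by R are identified.
HasSize : {A : Set} → Rel A 0ℓ → Pred A 0ℓ → ℕ → Set
HasSize {A} R P n =
  Σ[ xs ∈ List A ]
    length xs ≡ n ×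
    All P xs ×
    AllPairs (λ x y → ¬ R x y) xs ×
    (∀ x → P x → Any (R x) xs)

-- R holds between consecutive entries, and from the last to the first.
CyclicallyLinked : {A : Set} → Rel A 0ℓ → Pred (List A) 0ℓ
CyclicallyLinked R xs = Linked R (xs ++ take 1 xs)

record IsSubgroup (𝓖 : Group 0ℓ 0ℓ) (H : Pred (Group.Carrier 𝓖) 0ℓ) : Set where
  open Group 𝓖 using (_≈_; _∙_; _⁻¹) renaming (ε to e)
  field
    resp : ∀ {g h} → g ≈ h → H g → H h
    unit : H e
    mult : ∀ {g h} → H g → H h → H (g ∙ h)
    inv  : ∀ {g} → H g → H (g ⁻¹)

-- The element g has (finite) order ℓ.
HasOrder : (𝓖 : Group 0ℓ 0ℓ) → Group.Carrier 𝓖 → ℕ → Set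
HasOrder 𝓖 g ℓ =
  0 < ℓ × (ℓ ·′ g ≈ e) × (∀ k → 0 < k → k ·′ g ≈ e → ℓ ≤ k)
  where
  open Group 𝓖 using (_≈_; rawMonoid) renaming (ε to e)
  open RawMonoidDefs rawMonoid using () renaming (_×_ to _·′_)

------------------------------------------------------------------------
-- Finite, simple, undirected, connected graphs

record Graph : Set₁ where
  field
    Node      : Set
    _≟_       : DecidableEquality Node
    finite    : ∃[ k ] HasSize {Node} _≡_ U k
    Adj       : Rel Node 0ℓ
    symmetric : ∀ {x y} → Adj x y → Adj y x
    simple    : ∀ {x} → ¬ Adj x x
    connected : ∀ x y → Star Adj x y

  order : ℕ
  order = proj₁ finite

module _ (G : Graph) where
  open Graph G

  Cubic : Set
  Cubic = ∀ x → HasSize _≡_ (Adj x) 3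

  record GraphAut : Set where
    field
      perm     : Node ↔ Node
      preserve : ∀ {x y} → Adj x y ⇔ Adj (Inverse.to perm x) (Inverse.to perm y)

    infixr 9 _·_
    _·_ : Node → Node
    _·_ = Inverse.to perm

  open GraphAut

  private
    inverse : GraphAut → GraphAut
    perm (inverse σ) = ↔-sym (perm σ)
    preserve (inverse σ) {x} {y} = mk⇔
      (λ a → Equivalence.from (preserve σ)
               (subst₂ Adj (sym (Inverse.strictlyInverseˡ (perm σ) x))
                           (sym (Inverse.strictlyInverseˡ (perm σ) y)) a))
      (λ a → subst₂ Adj (Inverse.strictlyInverseˡ (perm σ) x)
                        (Inverse.strictlyInverseˡ (perm σ) y)
                        (Equivalence.to (preserve σ) a))

  autGroup : Group 0ℓ 0ℓ
  autGroup = record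
    { Carrier = GraphAut
    ; _≈_     = λ σ τ → ∀ x → σ · x ≡ τ · x
    ; _∙_     = λ σ τ → record
        { perm     = perm σ ↔-∘ perm τ
        ; preserve = preserve σ ⇔-∘ preserve τ
        }
    ; ε       = record { perm = ↔-id Node ; preserve = ⇔-id _ }
    ; _⁻¹     = inverse
    ; isGroup = record
      { isMonoid = record
        { isSemigroup = record
          { isMagma = record
            { isEquivalence = record
              { refl  = λ _ → refl
              ; sym   = λ p x → sym (p x)
              ; trans = λ p q x → trans (p x) (q x)
              }
            ; ∙-cong = λ {σ} {σ′} {τ} {τ′} p q x → trans (p (τ · x)) (cong (σ′ ·_) (q x))
            }
          ; assoc = λ _ _ _ _ → refl
          }
        ; identity = (λ _ _ → refl) , (λ _ _ → refl)
        }
      ; inverse = (λ σ → Inverse.strictlyInverseʳ (perm σ))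
                , (λ σ → Inverse.strictlyInverseˡ (perm σ))
      ; ⁻¹-cong = λ {σ} {τ} p x →
          trans (cong (Inverse.from (perm σ))
                  (trans (sym (Inverse.strictlyInverseˡ (perm τ) x))
                         (sym (p (Inverse.from (perm τ) x)))))
                (Inverse.strictlyInverseʳ (perm σ) (Inverse.from (perm τ) x))
      }
    }

  open Group autGroup using (_≈_; rawMonoid)

  _^_ : GraphAut → ℕ → GraphAut
  σ ^ i = i ·′ σ
    where open RawMonoidDefs rawMonoid using () renaming (_×_ to _·′_)

  NodeTransitive : Pred GraphAut 0ℓ → Set
  NodeTransitive H = ∀ x y → ∃[ σ ] H σ × σ · x ≡ y

  -- An arc {source , target}; the orientation is discarded by _≈ᵃ_.
  record Arc : Set where
    constructor arc
    field
      source target : Node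
      adjacent      : Adj source target

  open Arc

  _≈ᵃ_ : Rel Arc 0ℓ
  a ≈ᵃ b = (source a ≡ source b × target a ≡ target b)
         ⊎ (source a ≡ target b × target a ≡ source b)

  mapArc : GraphAut → Arc → Arc
  mapArc σ (arc x y a) = arc (σ · x) (σ · y) (Equivalence.to (preserve σ) a)

  ArcOrbit : Pred GraphAut 0ℓ → Arc → Pred Arc 0ℓ
  ArcOrbit H a b = ∃[ σ ] H σ × mapArc σ a ≈ᵃ b

  ----------------------------------------------------------------------
  -- Cycles, written as lists of nodes up to rotation and reversal

  IsCycle : Pred (List Node) 0ℓ
  IsCycle c = 3 ≤ length c × Unique c × CyclicallyLinked Adj c

  Rotation : Rel (List Node) 0ℓ
  Rotation c d = ∃[ xs ] ∃[ ys ] c ≡ xs ++ ys × d ≡ ys ++ xs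

  _≈ᶜ_ : Rel (List Node) 0ℓ
  c ≈ᶜ d = Rotation c d ⊎ Rotation (reverse c) d

  _liesIn_ : Arc → Pred (List Node) 0ℓ
  a liesIn c = ∃[ zs ] c ≈ᶜ (source a ∷ target a ∷ zs)

  CycleOrbit : Pred GraphAut 0ℓ → List Node → Pred (List Node) 0ℓ
  CycleOrbit H c d = ∃[ σ ] H σ × map (σ ·_) c ≈ᶜ d

  record IsCycleDoubleCover (C : Pred (List Node) 0ℓ) : Set where
    field
      cycles : ∀ c → C c → IsCycle c
      double : ∀ a → HasSize _≈ᶜ_ (λ c → C c × a liesIn c) 2

  Chordless : Pred (List Node) 0ℓ
  Chordless c = ∀ a → source a ∈ c → target a ∈ c → a liesIn c

  record IsVertexFaithful (C : Pred (List Node) 0ℓ) : Set where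
    field
      chordless  : ∀ c → C c → Chordless c
      atMostOne  : ∀ c d → C c → C d → ¬ (c ≈ᶜ d) →
                   ∀ a b → a liesIn c → a liesIn d → b liesIn c → b liesIn d → a ≈ᵃ b

  -- α σ ℓ (F₁ ∷ … ∷ Fₙ ∷ []) is the α-cycle when F₁,…,Fₙ is a walk,
  -- σ F₁ ≡ Fₙ, and ℓ is the order of σ; [] is the empty cycle.
  -- The number of distinct entries is |Σ|, and k is n - 1.
  α : ∀ {k} → GraphAut → ℕ → Vec Node (suc k) → List Node
  α {k} σ ℓ F =
    if does (length (deduplicate _≟_ (concatMap segment (upTo ℓ))) ℕ.≟ k * ℓ)
    then concatMap (λ i → segment (suc i)) (upTo ℓ)
    else []
    where
    segment : ℕ → List Node
    segment i = map ((σ ^ i) ·_) (toList (init F))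

  ----------------------------------------------------------------------
  -- (1,2)-groups, together with a choice of the data defining the cover

  record OneTwoGroup (H : Pred GraphAut 0ℓ) : Set where
    field
      cubic      : Cubic
      subgroup   : IsSubgroup autGroup H

      transitive : NodeTransitive H
      card       : HasSize _≈_ H (2 * order)

      -- e₁ and e₂ represent the two H-orbits E₁ and E₂.
      e₁ e₂      : Arc

    E₁ : Pred Arc 0ℓ
    E₁ = ArcOrbit H e₁

    E₂ : Pred Arc 0ℓ
    E₂ = ArcOrbit H e₂

    field
      covering   : ∀ a → E₁ a ⊎ E₂ a
      disjoint   : ∀ a → ¬ (E₁ a × E₂ a)
      card-E₁    : HasSize _≈ᵃ_ E₁ order
      card-E₂    : ∃[ k ] HasSize _≈ᵃ_ E₂ k × 2 * k ≡ order

      F₁ F₂ F₃ F₄ : Node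
      adj₁₂      : Adj F₁ F₂
      adj₂₃      : Adj F₂ F₃
      adj₃₄      : Adj F₃ F₄
      in-E₂      : E₂ (arc F₁ F₂ adj₁₂)
      in-E₁      : E₁ (arc F₂ F₃ adj₂₃)
      in-E₁′     : E₁ (arc F₃ F₄ adj₃₄)
      σ          : GraphAut
      ℓ          : ℕ
      order-σ    : HasOrder autGroup σ ℓ
      σ-F₁       : σ · F₁ ≡ F₄

    cover : Pred (List Node) 0ℓ
    cover = CycleOrbit H (α σ ℓ (F₁ ∷ F₂ ∷ F₃ ∷ F₄ ∷ []))

    field
      isCycleDoubleCover : IsCycleDoubleCover cover
      isVertexFaithful   : IsVertexFaithful cover

------------------------------------------------------------------------
-- Simplicial complexes

-- A complex on the set P = Fin size, as a characteristic function.
record SimplicialComplex : Set where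
  field
    size       : ℕ
    .{{size≢0}} : NonZero size
    member     : Subset size → Bool
    nonempty   : ∃[ S ] T (member S)
    closed     : ∀ {S S′} → S ⊆ S′ → T (member S′) → T (member S)

  -- The set Xᵢ of elements of cardinality i + 1.
  Simplex : ℕ → Set
  Simplex i = Σ[ S ∈ Subset size ] T (member S) × ∣ S ∣ ≡ suc i

  Vertex Edge Face : Set
  Vertex = Simplex 0
  Edge   = Simplex 1
  Face   = Simplex 2

  infix 4 _≼_
  _≼_ : ∀ {i j} → Simplex i → Simplex j → Set
  S ≼ S′ = proj₁ S ⊆ proj₁ S′

  Maximal : Pred (Subset size) 0ℓ
  Maximal S = T (member S) × (∀ S′ → T (member S′) → S ⊆ S′ → S ≡ S′)

  ShareEdge : Rel Face 0ℓ
  ShareEdge F G = Σ[ e ∈ Edge ] e ≼ F × e ≼ G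

  IsUmbrella : Vertex → Pred (List Face) 0ℓ
  IsUmbrella v Fs =
    Unique Fs ×
    (∀ F → F ∈ Fs ⇔ v ≼ F) ×
    CyclicallyLinked (λ F G → ∣ proj₁ F ∩ proj₁ G ∣ ≡ 2) Fs

record SimplicialSurface : Set where
  field
    complex : SimplicialComplex
  open SimplicialComplex complex public
  field
    pure              : ∀ S → Maximal S → ∣ S ∣ ≡ 3
    edge-in-two-faces : (e : Edge) → HasSize {Face} _≡_ (λ F → e ≼ F) 2
    umbrella          : Vertex → List Face
    isUmbrella        : ∀ v → IsUmbrella v (umbrella v)
    stronglyConnected : ∀ F G → Star ShareEdge F G

module _ (X : SimplicialSurface) where
  open SimplicialSurface X

  ----------------------------------------------------------------------
  -- Automorphisms

  -- The permutation π of the vertices maps the vertex set of F onto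
  -- that of G.
  _maps_to_ : Vertex ↔ Vertex → Rel Face 0ℓ
  π maps F to G = ∀ v → v ≼ F ⇔ Inverse.to π v ≼ G

  record SurfaceAut : Set where
    field
      perm  : Vertex ↔ Vertex
      faces : ∀ F → ∃[ G ] perm maps F to G

  open SurfaceAut

  _≈ˢ_ : Rel SurfaceAut 0ℓ
  π ≈ˢ ρ = ∀ v → Inverse.to (perm π) v ≡ Inverse.to (perm ρ) v

  SameVertexOrbit : Rel Vertex 0ℓ
  SameVertexOrbit v w = ∃[ π ] Inverse.to (perm π) v ≡ w

  FaceTransitive : Set
  FaceTransitive = ∀ F G → ∃[ π ] perm π maps F to G

  HasVF : ℕ → ℕ → Set
  HasVF a s =
    HasSize SameVertexOrbit U a ×
    (∀ F → HasSize _≈ˢ_ (λ π → perm π maps F to F) s)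

  ----------------------------------------------------------------------
  -- The face graph

  private
    _≟ᶠ_ : DecidableEquality Face
    (S , p , q) ≟ᶠ (S′ , p′ , q′) = map′
      (λ { refl → cong₂ (λ p q → S , p , q) (Bool.T-irrelevant p p′) (ℕ.≡-irrelevant q q′) })
      (cong proj₁)
      (Vec.≡-dec Bool._≟_ S S′)

    subsets : ∀ n → List (Subset n)
    subsets zero    = [] ∷ []
    subsets (suc n) = map (true ∷_) (subsets n) ++ map (false ∷_) (subsets n)

    subsets-complete : ∀ {n} (S : Subset n) → S ∈ subsets n
    subsets-complete []          = here refl
    subsets-complete (true  ∷ S) = ∈-++⁺ˡ (∈-map⁺ (true ∷_) (subsets-complete S))
    subsets-complete (false ∷ S) =
      ∈-++⁺ʳ (map (true ∷_) (subsets _)) (∈-map⁺ (false ∷_) (subsets-complete S))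

    facesOn : Subset size → List Face
    facesOn S with Bool.T? (member S) | ∣ S ∣ ℕ.≟ 3
    ... | yes p | yes q = (S , p , q) ∷ []
    ... | _     | _     = []

    facesOn-complete : ∀ F → F ∈ facesOn (proj₁ F)
    facesOn-complete (S , p , q) with Bool.T? (member S) | ∣ S ∣ ℕ.≟ 3
    ... | yes p′ | yes q′ = here (cong₂ (λ p q → S , p , q)
                                   (Bool.T-irrelevant p p′) (ℕ.≡-irrelevant q q′))
    ... | yes _  | no ¬q  with () ← ¬q q
    ... | no ¬p  | _      with () ← ¬p p

    allFaces : List Face
    allFaces = deduplicate _≟ᶠ_ (concatMap facesOn (subsets size))

    allFaces-complete : ∀ F → F ∈ allFaces
    allFaces-complete F = ∈-deduplicate⁺ _≟ᶠ_
      (∈-concatMap⁺ facesOn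
        (Any.map (λ { refl → facesOn-complete F }) (subsets-complete (proj₁ F))))

  FaceAdj : Rel Face 0ℓ
  FaceAdj F G = F ≢ G × ShareEdge F G

  private
    connect : ∀ {F G} → Star ShareEdge F G → Star FaceAdj F G
    connect ε = ε
    connect (_◅_ {F} {G} s ss) with F ≟ᶠ G
    ... | yes refl = connect ss
    ... | no  F≢G  = (F≢G , s) ◅ connect ss

  faceGraph : Graph
  faceGraph = record
    { Node      = Face
    ; _≟_       = _≟ᶠ_
    ; finite    = length allFaces , allFaces , refl , All.universal (λ _ → tt) _
                , deduplicate-! _≟ᶠ_ _ , (λ F _ → allFaces-complete F)
    ; Adj       = FaceAdj
    ; symmetric = λ { (F≢G , e , e≼F , e≼G) → F≢G ∘ sym , e , (λ {x} → e≼G {x}) , (λ {x} → e≼F {x}) }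
    ; simple    = λ { (F≢F , _) → F≢F refl }
    ; connected = λ F G → connect (stronglyConnected F G)
    }

  -- λ_X(Aut(X)): the automorphisms of the face graph that are the
  -- permutation of the faces induced by some automorphism of X.
  λ-image : Pred (GraphAut faceGraph) 0ℓ
  λ-image φ = Σ[ π ∈ SurfaceAut ] ∀ F → perm π maps F to (GraphAut._·_ φ F)

{-# OPTIONS --safe #-}

-- If the stabiliser of every face has order 2, its non-trivial element fixes one vertex
-- of the face, the apex, and swaps the other two; so the automorphisms are simply
-- transitive on the pairs of a face and a non-apex vertex of it. An edge of a face is a
-- leg if it contains the apex and the base otherwise. Counting shows that bases are glued
-- to bases and legs to legs, and vertex-transitivity that the apex changes across a leg.
-- Hence around each vertex v the edges through v are cyclically base, leg, leg, and the
-- automorphism that fixes v and moves three faces on exhibits the umbrella of v as an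
-- α-cycle; its orbit consists of all the umbrellas. Conversely, orbit-stabiliser gives the
-- order of the face stabilisers, and since the umbrellas lie in a single orbit and an
-- umbrella determines its vertex, there is a single orbit of vertices.

module Submission where

open import Algebra.Bundles using (Group)
open import Data.Bool using (T; T?; if_then_else_)
import Data.Bool.Properties as Bool
open import Data.Fin using (Fin)
import Data.Fin.Base as Fin
import Data.Fin.Properties as Fin
open import Data.Fin.Subset
  using (Subset; inside; outside; _⊆_; _⊂_; _∩_; _∪_; ∣_∣; ⁅_⁆) renaming (_∈_ to _∈ˢ_)
import Data.Fin.Subset.Properties as Subset
open import Data.List.Base
  using (List; []; _∷_; _++_; length; map; concatMap; reverse; applyUpTo; take; deduplicate;
         initLast; _∷ʳ′_; upTo; filter)
open import Data.List.Membership.Propositional using (_∈_; _∉_)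
open import Data.List.Membership.Propositional.Properties
  using (∈-++⁺ˡ; ∈-++⁺ʳ; ∈-++⁻; ∈-∃++; ∈-applyUpTo⁺; ∈-map⁺)
import Data.List.Properties as List
open import Data.List.Relation.Unary.All using (All; []; _∷_)
import Data.List.Relation.Unary.All as All
import Data.List.Relation.Unary.All.Properties as All
open import Data.List.Relation.Unary.AllPairs using (AllPairs; []; _∷_)
import Data.List.Relation.Unary.AllPairs as AllPairs
import Data.List.Relation.Unary.AllPairs.Properties as AllPairs
open import Data.List.Relation.Unary.Any using (Any; here; there)
import Data.List.Relation.Unary.Any as Any
import Data.List.Relation.Unary.Any.Properties as Any
open import Data.List.Relation.Unary.Linked using (Linked; []; [-]; _∷_)
import Data.List.Relation.Unary.Linked as Linked
import Data.List.Relation.Unary.Linked.Properties as Linked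
open import Data.List.Relation.Unary.Unique.Propositional using (Unique)
import Data.List.Relation.Unary.Unique.Propositional.Properties as Unique
open import Data.Nat
  using (ℕ; zero; suc; _+_; _*_; _≤_; _<_; z≤n; s≤s; _/_; _%_; _≤?_; NonZero)
open import Data.Nat.DivMod using (m≡m%n+[m/n]*n; m%n<n)
import Data.Nat.Properties as ℕ
open import Data.Product using (Σ; Σ-syntax; ∃-syntax; _×_; _,_; proj₁; proj₂; swap)
open import Data.Product.Properties using (,-injective; ≡-dec)
open import Data.Sum using (_⊎_; inj₁; inj₂; [_,_]′)
import Data.Sum as Sum
open import Data.Unit using (tt)
open import Data.Vec.Base using (Vec; []; _∷_; toList; init)
import Data.Vec.Base as Vec
open import Function.Base using (_∘_; id)
open import Function.Bundles using (Equivalence; _↔_; _⇔_; Inverse; mk⇔; mk↔ₛ′)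
open import Function.Construct.Composition using (_↔-∘_)
open import Function.Construct.Identity using (↔-id)
open import Function.Construct.Symmetry using (↔-sym)
open import Level using (0ℓ)
open import Relation.Binary using (Rel; IsEquivalence; DecidableEquality; Symmetric)
open import Relation.Binary.Construct.Closure.ReflexiveTransitive using (Star; ε; _◅_)
open import Relation.Binary.PropositionalEquality
  using (_≡_; _≢_; refl; sym; trans; cong; cong₂; subst; isEquivalence; subst₂)
open import Relation.Nullary using (¬_; yes; no; contradiction; Dec)
open import Relation.Nullary.Decidable using (¬?; map′; _×-dec_; dec-true)
open import Relation.Unary using (Pred; U; Decidable)

open import Defs

-- Two facts about arbitrary surfaces carry the argument. Rigidity: an automorphism that fixes the
-- vertices of one face is the identity, because agreement spreads across edges and the surface is
-- strongly connected; so a non-trivial stabiliser element cannot fix two vertices of its face.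
-- Uniqueness: a face at `v` has exactly two edges through `v`, so a cyclic arrangement of the faces
-- at `v` is determined up to rotation and reversal. This allows the orbit of one α-cycle to be
-- compared with the umbrellas given as data. The set of all umbrellas is a double cover because an
-- arc lies in the umbrellas of the two ends of its edge, and vertex-faithful because two umbrellas
-- can share only the arc across the edge joining their vertices. The group consists of permutations
-- of faces, whereas the geometry moves vertices. The two are interchangeable since a vertex is
-- determined by the faces that contain it. The order of the rotation at `v` is a third of the
-- degree of `v`: the pattern of edges closes up after a full turn, so 3 divides the degree.

-- Counting

-- Opaque, so that with-abstraction over an application does not normalise the proof.
opaque

  remove-Any : {A : Set} {P : Pred A 0ℓ} {ys : List A} → Any P ys →
    Σ[ zs ∈ List A ] length ys ≡ suc (length zs) ×
      ({Q : Pred A 0ℓ} → Any Q ys → (∃[ y ] P y × Q y) ⊎ Any Q zs)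
  remove-Any (here p) = _ , refl , λ where
    (here q)  → inj₁ (_ , p , q)
    (there q) → inj₂ q
  remove-Any (there p) with zs , eq , f ← remove-Any p =
    _ ∷ zs , cong suc eq , λ where
      (here q)  → inj₂ (here q)
      (there q) → Sum.map₂ there (f q)

module _ {A : Set} {R : Rel A 0ℓ} (equiv : IsEquivalence R) where
  private module R = IsEquivalence equiv

  opaque

    -- Two entries of `xs` related to the same entry of `ys` would be related to each other; so the
    -- partner of the head can be deleted from `ys` without affecting the rest.
    pigeonhole : ∀ {xs ys} → AllPairs (λ x y → ¬ R x y) xs →
      (∀ {x} → x ∈ xs → Any (R x) ys) → length xs ≤ length ys
    pigeonhole [] _ = z≤n
    pigeonhole {x ∷ xs} {ys} (x≁xs ∷ xs!) xs⊆ys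
      with zs , eq , f ← remove-Any (xs⊆ys (here refl)) =
      subst (suc (length xs) ≤_) (sym eq) (s≤s (pigeonhole xs! xs⊆zs))
      where
      xs⊆zs : ∀ {y} → y ∈ xs → Any (R y) zs
      xs⊆zs y∈xs with f (xs⊆ys (there y∈xs))
      ... | inj₁ (_ , Rxz , Ryz) =
        contradiction (R.trans Rxz (R.sym Ryz)) (All.lookup x≁xs y∈xs)
      ... | inj₂ y∈zs = y∈zs

    HasSize-unique : ∀ {P m n} → HasSize R P m → HasSize R P n → m ≡ n
    HasSize-unique (xs , refl , Pxs , xs! , xs-all) (ys , refl , Pys , ys! , ys-all) =
      ℕ.≤-antisym
        (pigeonhole xs! (ys-all _ ∘ All.lookup Pxs))
        (pigeonhole ys! (xs-all _ ∘ All.lookup Pys))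

opaque

  -- Completeness of the list only supplies some `x′` related to the preimage `x`, with its own
  -- proof of `P x′`; hence the surjectivity hypothesis covers every such `x′`.
  HasSize-map : {A B : Set} {R : Rel A 0ℓ} {S : Rel B 0ℓ} {P : Pred A 0ℓ} {Q : Pred B 0ℓ}
    {n : ℕ} (f : ∀ x → P x → B) →
    (∀ x p → Q (f x p)) →
    (∀ {x y p q} → S (f x p) (f y q) → R x y) →
    (∀ y → Q y → ∃[ x ] P x × (∀ x′ p′ → R x x′ → S y (f x′ p′))) →
    HasSize R P n → HasSize S Q n
  HasSize-map {A} {B} {R} {S} {P} {Q} f f∈ f-inj f-surj (xs , refl , Pxs , xs! , xs-all) =
    image Pxs , length-image Pxs , all Pxs , pairs xs! Pxs , complete
    where
    image : ∀ {xs} → All P xs → List B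
    image = All.reduce (λ {x} → f x)

    length-image : ∀ {xs} (Pxs : All P xs) → length (image Pxs) ≡ length xs
    length-image []         = refl
    length-image (_ ∷ Pxs) = cong suc (length-image Pxs)

    all : ∀ {xs} (Pxs : All P xs) → All Q (image Pxs)
    all []         = []
    all (p ∷ Pxs) = f∈ _ p ∷ all Pxs

    apart : ∀ {x p xs} → All (λ y → ¬ R x y) xs → (Pxs : All P xs) →
      All (λ z → ¬ S (f x p) z) (image Pxs)
    apart []       []         = []
    apart (r ∷ rs) (_ ∷ Pxs) = r ∘ f-inj ∷ apart rs Pxs

    pairs : ∀ {xs} → AllPairs (λ x y → ¬ R x y) xs → (Pxs : All P xs) →
      AllPairs (λ x y → ¬ S x y) (image Pxs)
    pairs []        []         = []
    pairs (r ∷ rs) (_ ∷ Pxs) = apart r Pxs ∷ pairs rs Pxs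

    any : ∀ {x y xs} → (∀ x′ p′ → R x x′ → S y (f x′ p′)) → (Pxs : All P xs) →
      Any (R x) xs → Any (S y) (image Pxs)
    any h (p ∷ _)   (here r)  = here (h _ p r)
    any h (_ ∷ Pxs) (there i) = there (any h Pxs i)

    complete : ∀ y → Q y → Any (S y) (image Pxs)
    complete y q with x , p , h ← f-surj y q = any h Pxs (xs-all x p)

  HasSize-⇔ : {A : Set} {R : Rel A 0ℓ} {P Q : Pred A 0ℓ} {n : ℕ} →
    (∀ {x} → P x → Q x) → (∀ {x} → Q x → P x) → HasSize R P n → HasSize R Q n
  HasSize-⇔ P⇒Q Q⇒P (xs , len , Pxs , xs! , all) =
    xs , len , All.map P⇒Q Pxs , xs! , λ x → all x ∘ Q⇒P

  -- Entries from different fibres are unrelated because `f` respects `R`. It serves both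
  -- orbit-stabiliser and the count of oriented arcs by source.
  HasSize-fibres : {A I : Set} {R : Rel A 0ℓ} {P : Pred A 0ℓ} {m n : ℕ} (f : A → I) →
    (∀ {x y} → R x y → f x ≡ f y) →
    HasSize {I} _≡_ U n →
    (∀ i → HasSize R (λ x → P x × f x ≡ i) m) →
    HasSize R P (n * m)
  HasSize-fibres {A} {I} {R} {P} {m} f f-resp (is , refl , _ , is! , is-all) fibre =
    concatMap list is , length-list is , all is , pairs is! , λ x p →
      complete p (is-all (f x) tt)
    where
    list : I → List A
    list i = proj₁ (fibre i)

    fibre-all : ∀ i → All (λ x → P x × f x ≡ i) (list i)
    fibre-all i = proj₁ (proj₂ (proj₂ (fibre i)))

    length-list : ∀ is → length (concatMap list is) ≡ length is * m
    length-list []       = refl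
    length-list (i ∷ is) = trans (List.length-++ (list i))
      (cong₂ _+_ (proj₁ (proj₂ (fibre i))) (length-list is))

    all : ∀ is → All P (concatMap list is)
    all []       = []
    all (i ∷ is) = All.++⁺ (All.map proj₁ (fibre-all i)) (all is)

    apart : ∀ {i x is} → f x ≡ i → All (i ≢_) is → All (λ y → ¬ R x y) (concatMap list is)
    apart eq [] = []
    apart {is = j ∷ _} eq (i≢j ∷ i∉is) = All.++⁺
      (All.map (λ (_ , fy≡j) r → i≢j (trans (sym eq) (trans (f-resp r) fy≡j))) (fibre-all j))
      (apart eq i∉is)

    pairs : ∀ {is} → Unique is → AllPairs (λ x y → ¬ R x y) (concatMap list is)
    pairs []                        = []
    pairs {i ∷ _} (i∉is ∷ is!) = AllPairs.++⁺
      (proj₁ (proj₂ (proj₂ (proj₂ (fibre i)))))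
      (pairs is!)
      (All.map (λ (_ , eq) → apart eq i∉is) (fibre-all i))

    complete : ∀ {x is} → P x → f x ∈ is → Any (R x) (concatMap list is)
    complete {x} p (here refl) = Any.++⁺ˡ (proj₂ (proj₂ (proj₂ (proj₂ (fibre (f x))))) x (p , refl))
    complete {is = j ∷ _} p (there i∈is) = Any.++⁺ʳ (list j) (complete p i∈is)

  HasSize-pair : {A : Set} {R : Rel A 0ℓ} {P : Pred A 0ℓ} (x y : A) → P x → P y → ¬ R x y →
    (∀ z → P z → R z x ⊎ R z y) → HasSize R P 2
  HasSize-pair x y px py x≁y all =
    x ∷ y ∷ [] , refl , px ∷ py ∷ [] , (x≁y ∷ []) ∷ [] ∷ [] ,
    λ z pz → [ here , there ∘ here ]′ (all z pz)

module _ {A : Set} (_≟_ : DecidableEquality A) {P : Pred A 0ℓ} (ι : A → A)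
  (ι-P : ∀ {x} → P x → P (ι x)) (ι-invol : ∀ {x} → P x → ι (ι x) ≡ x) (ι-free : ∀ {x} → P x → ι x ≢ x)
  where

  private
    _~_ : Rel A 0ℓ
    x ~ y = x ≡ y ⊎ x ≡ ι y

  -- A free involution pairs off the entries: `x` is kept and `ι x` is cut out of the tail. What is
  -- left is not a structural subterm, so the recursion runs on `bound`.
  halve : ∀ bound {xs} → length xs ≤ bound → Unique xs →
    (∀ {x} → x ∈ xs → P x) → (∀ {x} → x ∈ xs → ι x ∈ xs) →
    Σ[ ys ∈ List A ] 2 * length ys ≡ length xs × (∀ {y} → y ∈ ys → y ∈ xs) ×
      AllPairs (λ x y → ¬ (x ~ y)) ys × (∀ {x} → x ∈ xs → Any (x ~_) ys)
  halve _ {[]} _ _ _ _ = [] , refl , id , [] , λ ()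
  halve (suc bound) {x ∷ xs} (s≤s len) (x∉xs ∷ xs!) P-xs ι-xs with ι-xs (here refl)
  ... | here ιx≡x = contradiction ιx≡x (ι-free (P-xs (here refl)))
  ... | there ιx∈xs with as , bs , refl ← ∈-∃++ ιx∈xs =
    x ∷ ys ,
    trans (ℕ.*-suc 2 (length ys)) (trans (cong (suc ∘ suc) (proj₁ (proj₂ IH))) (sym (cong suc length-rest))) ,
    (λ { (here refl) → here refl ; (there y∈ys) → widen (ys⊆ y∈ys) }) ,
    All.tabulate fresh ∷ ys! ,
    complete
    where
    rest = as ++ bs

    length-rest : length (as ++ ι x ∷ bs) ≡ suc (length rest)
    length-rest = trans (List.length-++ as)
      (trans (ℕ.+-suc (length as) (length bs)) (cong suc (sym (List.length-++ as))))

    shorter : length rest ≤ bound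
    shorter = ℕ.≤-trans (ℕ.n≤1+n _) (subst (_≤ bound) length-rest len)

    inner : ∀ {y} → y ∈ rest → y ∈ as ++ ι x ∷ bs
    inner y∈ = [ ∈-++⁺ˡ , ∈-++⁺ʳ as ∘ there ]′ (∈-++⁻ as y∈)

    widen : ∀ {y} → y ∈ rest → y ∈ x ∷ as ++ ι x ∷ bs
    widen = there ∘ inner

    narrow : ∀ {y} → y ∈ as ++ ι x ∷ bs → y ≢ ι x → y ∈ rest
    narrow y∈ y≢ with ∈-++⁻ as y∈
    ... | inj₁ y∈as         = ∈-++⁺ˡ y∈as
    ... | inj₂ (here eq)    = contradiction eq y≢
    ... | inj₂ (there y∈bs) = ∈-++⁺ʳ as y∈bs

    split! : ∀ as → Unique (as ++ ι x ∷ bs) → Unique (as ++ bs) × ι x ∉ as ++ bs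
    split! []       (p ∷ ps) = ps , λ i → All.lookup p i refl
    split! (a ∷ as) (p ∷ ps) with u , n ← split! as ps =
      All.++⁺ (All.++⁻ˡ as p) (All.tail (All.++⁻ʳ as p)) ∷ u ,
      λ { (here eq) → All.head (All.++⁻ʳ as p) (sym eq) ; (there i) → n i }

    rest! = proj₁ (split! as xs!)
    ιx∉rest = proj₂ (split! as xs!)

    x∉rest : x ∉ rest
    x∉rest x∈ = All.lookup x∉xs (inner x∈) refl

    closed : ∀ {y} → y ∈ rest → ι y ∈ rest
    closed {y} y∈ with ι-xs (widen y∈)
    ... | here ιy≡x = contradiction
      (subst (_∈ rest) (trans (sym (ι-invol (P-xs (widen y∈)))) (cong ι ιy≡x)) y∈) ιx∉rest
    ... | there ιy∈ = narrow ιy∈ λ ιy≡ιx → x∉rest (subst (_∈ rest)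
      (trans (sym (ι-invol (P-xs (widen y∈)))) (trans (cong ι ιy≡ιx) (ι-invol (P-xs (here refl))))) y∈)

    IH = halve bound shorter rest! (P-xs ∘ widen) closed
    ys = proj₁ IH

    ys⊆ : ∀ {y} → y ∈ ys → y ∈ rest
    ys⊆ = proj₁ (proj₂ (proj₂ IH))

    ys! = proj₁ (proj₂ (proj₂ (proj₂ IH)))

    fresh : ∀ {y} → y ∈ ys → ¬ (x ~ y)
    fresh y∈ys (inj₁ refl) = x∉rest (ys⊆ y∈ys)
    fresh y∈ys (inj₂ refl) = x∉rest (closed (ys⊆ y∈ys))

    complete : ∀ {y} → y ∈ x ∷ as ++ ι x ∷ bs → Any (y ~_) (x ∷ ys)
    complete (here refl) = here (inj₁ refl)
    complete {y} (there y∈) with y ≟ ι x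
    ... | yes eq = here (inj₂ eq)
    ... | no neq = there (proj₂ (proj₂ (proj₂ (proj₂ IH))) (narrow y∈ neq))

  opaque

    HasSize-halve : ∀ {n} → HasSize _≡_ P n → ∃[ k ] 2 * k ≡ n × HasSize (λ x y → x ≡ y ⊎ x ≡ ι y) P k
    HasSize-halve (xs , refl , Pxs , xs! , xs-all) =
      let ys , 2k≡n , ys⊆xs , ys! , all =
            halve (length xs) ℕ.≤-refl xs! (All.lookup Pxs)
              (λ x∈xs → xs-all _ (ι-P (All.lookup Pxs x∈xs)))
      in length ys , 2k≡n , ys , refl , All.tabulate (All.lookup Pxs ∘ ys⊆xs) , ys! ,
         λ x p → all (xs-all x p)

opaque

  -- A missed `y` in front of the list of images would give one distinct element too many.
  injective⇒surjective : {A : Set} → DecidableEquality A → ∀ {n} → HasSize {A} _≡_ U n →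
    (f : A → A) → (∀ {x y} → f x ≡ f y → x ≡ y) → ∀ y → ∃[ x ] f x ≡ y
  injective⇒surjective _≟_ (xs , _ , _ , xs! , xs-all) f f-inj y
    with Any.any? (λ x → f x ≟ y) xs
  ... | yes found = Any.satisfied found
  ... | no  none  = contradiction
    (subst (_≤ length xs) (cong suc (List.length-map f xs))
      (pigeonhole isEquivalence
        (All.map⁺ (All.map (λ fx≢y y≡fx → fx≢y (sym y≡fx)) (All.¬Any⇒All¬ xs none))
          ∷ Unique.map⁺ f-inj xs!)
        λ {x} _ → xs-all x tt))
    ℕ.1+n≰n

  HasSize-filter : {A : Set} {R : Rel A 0ℓ} {P Q : Pred A 0ℓ} {n : ℕ} (Q? : Decidable Q) →
    (∀ {x y} → R x y → Q x → Q y) →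
    HasSize R P n → ∃[ m ] HasSize R (λ x → P x × Q x) m
  HasSize-filter {A} {R} {P} {Q} Q? Q-resp (xs , _ , Pxs , xs! , xs-all) =
    length (filter Q? xs) , filter Q? xs , refl ,
    All.zip (All.filter⁺ Q? Pxs , All.all-filter Q? xs) , AllPairs.filter⁺ Q? xs! ,
    λ x (p , q) → keep q (xs-all x p)
    where
    keep : ∀ {x xs} → Q x → Any (R x) xs → Any (R x) (filter Q? xs)
    keep {xs = y ∷ _} q i with Q? y
    keep q (here r)  | yes _  = here r
    keep q (there i) | yes _  = there (keep q i)
    keep q (here r)  | no ¬q = contradiction (Q-resp r q) ¬q
    keep q (there i) | no _   = keep q i

  HasSize-nonZero : {A : Set} {R : Rel A 0ℓ} {P : Pred A 0ℓ} {n : ℕ} {x : A} →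
    P x → HasSize R P n → NonZero n
  HasSize-nonZero p ([]    , _    , _ , _ , all) with () ← all _ p
  HasSize-nonZero p (_ ∷ _ , refl , _)           = _

-- Cyclic lists

module _ {A : Set} where

  rotate : List A → List A
  rotate []       = []
  rotate (x ∷ xs) = xs ++ x ∷ []

  rotateBy : ℕ → List A → List A
  rotateBy zero    xs = xs
  rotateBy (suc n) xs = rotateBy n (rotate xs)

  rotateBy-++ : ∀ xs ys → rotateBy (length xs) (xs ++ ys) ≡ ys ++ xs
  rotateBy-++ []       ys = sym (List.++-identityʳ ys)
  rotateBy-++ (x ∷ xs) ys = trans
    (cong (rotateBy (length xs)) (List.++-assoc xs ys (x ∷ [])))
    (trans (rotateBy-++ xs (ys ++ x ∷ [])) (List.++-assoc ys (x ∷ []) xs))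

  rotateBy-length : ∀ xs → rotateBy (length xs) xs ≡ xs
  rotateBy-length xs =
    trans (cong (rotateBy (length xs)) (sym (List.++-identityʳ xs))) (rotateBy-++ xs [])

  rotateBy-resp : (P : Pred (List A) 0ℓ) → (∀ xs → P xs → P (rotate xs)) →
    ∀ n xs → P xs → P (rotateBy n xs)
  rotateBy-resp P step zero    xs p = p
  rotateBy-resp P step (suc n) xs p = rotateBy-resp P step n (rotate xs) (step xs p)

  length-rotate : ∀ xs → length (rotate xs) ≡ length xs
  length-rotate []       = refl
  length-rotate (x ∷ xs) = trans (List.length-++ xs) (ℕ.+-comm (length xs) 1)

  length-rotateBy : ∀ n xs → length (rotateBy n xs) ≡ length xs
  length-rotateBy n xs = rotateBy-resp (λ ys → length ys ≡ length xs)
    (λ ys eq → trans (length-rotate ys) eq) n xs refl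

  All-rotate : {P : Pred A 0ℓ} → ∀ xs → All P xs → All P (rotate xs)
  All-rotate []       []       = []
  All-rotate (x ∷ xs) (p ∷ ps) = All.++⁺ ps (p ∷ [])

  Unique-rotate : ∀ xs → Unique xs → Unique (rotate xs)
  Unique-rotate []       []         = []
  Unique-rotate (x ∷ xs) (x∉ ∷ xs!) = AllPairs.++⁺ xs! ([] ∷ [])
    (All.map (λ x≢y → (x≢y ∘ sym) ∷ []) x∉)

  module _ {R : Rel A 0ℓ} where

    Linked-∷ʳ : ∀ zs {x y} → Linked R (zs ++ x ∷ []) → R x y →
      Linked R ((zs ++ x ∷ []) ++ y ∷ [])
    Linked-∷ʳ []           l       r = r ∷ [-]
    Linked-∷ʳ (z ∷ [])     (q ∷ l) r = q ∷ Linked-∷ʳ [] l r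
    Linked-∷ʳ (z ∷ w ∷ zs) (q ∷ l) r = q ∷ Linked-∷ʳ (w ∷ zs) l r

    CyclicallyLinked-rotate : ∀ xs → CyclicallyLinked R xs → CyclicallyLinked R (rotate xs)
    CyclicallyLinked-rotate []           l       = l
    CyclicallyLinked-rotate (x ∷ [])     l       = l
    CyclicallyLinked-rotate (x ∷ y ∷ xs) (r ∷ l) = Linked-∷ʳ (y ∷ xs) l r

    module _ (R-sym : Symmetric R) where

      Linked-reverse : ∀ {xs} → Linked R xs → Linked R (reverse xs)
      Linked-reverse []  = []
      Linked-reverse [-] = [-]
      Linked-reverse {x ∷ y ∷ xs} (r ∷ l) = subst (Linked R)
        (sym (trans (List.unfold-reverse x (y ∷ xs))
                    (cong (_++ x ∷ []) (List.unfold-reverse y xs))))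
        (Linked-∷ʳ (reverse xs)
          (subst (Linked R) (List.unfold-reverse y xs) (Linked-reverse l))
          (R-sym r))

      CyclicallyLinked-reverse : ∀ xs → CyclicallyLinked R xs → CyclicallyLinked R (reverse xs)
      CyclicallyLinked-reverse []       l = l
      CyclicallyLinked-reverse (x ∷ xs) l = subst (CyclicallyLinked R)
        (sym (List.unfold-reverse x xs))
        (CyclicallyLinked-rotate (x ∷ reverse xs)
          (subst (Linked R)
            (trans (List.reverse-++ (x ∷ xs) (x ∷ []))
                   (cong (x ∷_) (List.unfold-reverse x xs)))
            (Linked-reverse l)))

  Unique-reverse : ∀ {xs : List A} → Unique xs → Unique (reverse xs)
  Unique-reverse []                    = []
  Unique-reverse {x ∷ xs} (x∉ ∷ xs!) = subst Unique (sym (List.unfold-reverse x xs))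
    (Unique-rotate (x ∷ reverse xs) (All.tabulate (All.lookup x∉ ∘ Any.reverse⁻) ∷ Unique-reverse xs!))

  deduplicate-Unique : (_≟_ : DecidableEquality A) → ∀ {xs} → Unique xs →
    deduplicate _≟_ xs ≡ xs
  deduplicate-Unique _≟_ []                    = refl
  deduplicate-Unique _≟_ {x ∷ xs} (x∉ ∷ xs!)
    rewrite deduplicate-Unique _≟_ xs! = cong (x ∷_) (List.filter-all (¬? ∘ (x ≟_)) x∉)

  -- The entry of the infinite periodic sequence x xs x xs … at a given index.
  entry : A → List A → ℕ → A
  entry x xs       zero    = x
  entry x []       (suc n) = entry x [] n
  entry x (y ∷ ys) (suc n) = entry y (ys ++ x ∷ []) n

  entry-All : {P : Pred A 0ℓ} → ∀ x xs → All P (x ∷ xs) → ∀ n → P (entry x xs n)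
  entry-All x xs       (p ∷ ps) zero    = p
  entry-All x []       ps       (suc n) = entry-All x [] ps n
  entry-All x (y ∷ ys) ps       (suc n) = entry-All y (ys ++ x ∷ []) (All-rotate _ ps) n

  entry-Linked : {R : Rel A 0ℓ} → ∀ x xs → CyclicallyLinked R (x ∷ xs) →
    ∀ n → R (entry x xs n) (entry x xs (suc n))
  entry-Linked x []       (r ∷ _) zero    = r
  entry-Linked x (y ∷ ys) (r ∷ _) zero    = r
  entry-Linked x []       l       (suc n) = entry-Linked x [] l n
  entry-Linked x (y ∷ ys) l       (suc n) =
    entry-Linked y (ys ++ x ∷ []) (CyclicallyLinked-rotate (x ∷ y ∷ ys) l) n

  -- This reduces claims about an arbitrary index to index 0 of a rotated list.
  entry-rotate : ∀ i x xs → ∃[ zs ] rotateBy i (x ∷ xs) ≡ entry x xs i ∷ zs ×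
    (∀ j → entry (entry x xs i) zs j ≡ entry x xs (i + j))
  entry-rotate zero    x xs       = xs , refl , λ _ → refl
  entry-rotate (suc i) x []       = entry-rotate i x []
  entry-rotate (suc i) x (y ∷ ys) = entry-rotate i y (ys ++ x ∷ [])

  entry-period : ∀ x xs j → entry x xs (suc (length xs) + j) ≡ entry x xs j
  entry-period x xs j with zs , eq , h ← entry-rotate (suc (length xs)) x xs =
    let e = trans (sym (rotateBy-length (x ∷ xs))) eq in
    sym (trans (cong₂ (λ y ys → entry y ys j) (List.∷-injectiveˡ e) (List.∷-injectiveʳ e)) (h j))

  applyUpTo-cong : ∀ {f g : ℕ → A} → (∀ i → f i ≡ g i) → ∀ n → applyUpTo f n ≡ applyUpTo g n
  applyUpTo-cong f≗g zero    = refl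
  applyUpTo-cong f≗g (suc n) = cong₂ _∷_ (f≗g 0) (applyUpTo-cong (f≗g ∘ suc) n)

  -- Unfolding `entry` moves the head to the end of the list; the extra tail `ys` absorbs these
  -- entries in the induction.
  applyUpTo-entry-++ : ∀ x xs ys → applyUpTo (entry x (xs ++ ys)) (suc (length xs)) ≡ x ∷ xs
  applyUpTo-entry-++ x []       ys = refl
  applyUpTo-entry-++ x (y ∷ xs) ys = cong (x ∷_)
    (trans (cong (λ zs → applyUpTo (entry y zs) (suc (length xs))) (List.++-assoc xs ys (x ∷ [])))
           (applyUpTo-entry-++ y xs (ys ++ x ∷ [])))

  applyUpTo-entry : ∀ x xs → applyUpTo (entry x xs) (suc (length xs)) ≡ x ∷ xs
  applyUpTo-entry x xs =
    subst (λ zs → applyUpTo (entry x zs) (suc (length xs)) ≡ x ∷ xs) (List.++-identityʳ xs)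
      (applyUpTo-entry-++ x xs [])

  applyUpTo-entry-+ : ∀ i x xs →
    applyUpTo (λ j → entry x xs (i + j)) (suc (length xs)) ≡ rotateBy i (x ∷ xs)
  applyUpTo-entry-+ i x xs with zs , eq , h ← entry-rotate i x xs = trans
    (applyUpTo-cong (λ j → sym (h j)) (suc (length xs)))
    (trans (cong (applyUpTo (entry _ zs))
             (trans (sym (length-rotateBy i (x ∷ xs))) (cong length eq)))
           (trans (applyUpTo-entry _ zs) (sym eq)))

  entry-distinct₀ : ∀ {x xs} → Unique (x ∷ xs) →
    ∀ j → 0 < j → j ≤ length xs → entry x xs j ≢ x
  entry-distinct₀ {x} {xs} (x∉ ∷ _) (suc j) _ j≤ eq = All.lookup x∉
    (subst (entry x xs (suc j) ∈_)
      (List.∷-injectiveʳ (applyUpTo-entry x xs))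
      (∈-applyUpTo⁺ (entry x xs ∘ suc) j≤))
    (sym eq)

  entry-distinct : ∀ {x xs} → Unique (x ∷ xs) →
    ∀ i j → 0 < j → j ≤ length xs → entry x xs (i + j) ≢ entry x xs i
  entry-distinct {x} {xs} xs! i j 0<j j≤ eq with zs , eq′ , h ← entry-rotate i x xs =
    entry-distinct₀
      (subst Unique eq′ (rotateBy-resp Unique Unique-rotate i (x ∷ xs) xs!))
      j 0<j
      (subst (j ≤_) (ℕ.suc-injective (trans (sym (length-rotateBy i (x ∷ xs))) (cong length eq′))) j≤)
      (trans (h j) eq)

  -- `h` is general because the recursion turns `upTo`, which is `applyUpTo id`, into
  -- `applyUpTo suc` and so on.
  concatMap-applyUpTo-triples : (g : ℕ → List A) (h : ℕ → ℕ) (s : ℕ → A) → ∀ n →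
    (∀ i → g (h i) ≡ s (i * 3 + 0) ∷ s (i * 3 + 1) ∷ s (i * 3 + 2) ∷ []) →
    concatMap g (applyUpTo h n) ≡ applyUpTo s (n * 3)
  concatMap-applyUpTo-triples g h s zero    eq = refl
  concatMap-applyUpTo-triples g h s (suc n) eq = cong₂ _++_ (eq 0)
    (concatMap-applyUpTo-triples g (h ∘ suc) (s ∘ (3 +_)) n (eq ∘ suc))

-- Faces, vertices and edges of a surface

HasSize-∈ : ∀ {n} (S : Subset n) → HasSize _≡_ (_∈ˢ S) ∣ S ∣
HasSize-∈ [] = [] , refl , [] , [] , λ { _ () }
HasSize-∈ (outside ∷ S) with xs , len , in-S , xs! , all ← HasSize-∈ S =
  map Fin.suc xs , trans (List.length-map Fin.suc xs) len , All.map⁺ (All.map Vec.there in-S) ,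
  Unique.map⁺ Fin.suc-injective xs! ,
  λ { (Fin.suc i) (Vec.there i∈S) → Any.map⁺ (Any.map (cong Fin.suc) (all i i∈S)) }
HasSize-∈ (inside ∷ S) with xs , len , in-S , xs! , all ← HasSize-∈ S =
  Fin.zero ∷ map Fin.suc xs , cong suc (trans (List.length-map Fin.suc xs) len) ,
  Vec.here ∷ All.map⁺ (All.map Vec.there in-S) ,
  All.map⁺ (All.universal (λ _ ()) xs) ∷ Unique.map⁺ Fin.suc-injective xs! ,
  λ { Fin.zero    Vec.here        → here refl
    ; (Fin.suc i) (Vec.there i∈S) → there (Any.map⁺ (Any.map (cong Fin.suc) (all i i∈S))) }

⊆⇒≡⊎⊂ : ∀ {n} {S S′ : Subset n} → S ⊆ S′ → S ≡ S′ ⊎ S ⊂ S′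
⊆⇒≡⊎⊂ {S = S} {S′} S⊆S′ with S Subset.⊂? S′
... | yes S⊂S′ = inj₂ S⊂S′
... | no  S⊄S′ = inj₁ (Subset.⊆-antisym S⊆S′ S′⊆S)
  where
  S′⊆S : S′ ⊆ S
  S′⊆S {i} i∈S′ with i Subset.∈? S
  ... | yes i∈S = i∈S
  ... | no  i∉S = contradiction ((λ {x} → S⊆S′ {x}) , i , i∈S′ , i∉S) S⊄S′

⊆∧∣∣≡⇒≡ : ∀ {n} {S S′ : Subset n} → S ⊆ S′ → ∣ S ∣ ≡ ∣ S′ ∣ → S ≡ S′
⊆∧∣∣≡⇒≡ S⊆S′ eq with ⊆⇒≡⊎⊂ S⊆S′
... | inj₁ S≡S′ = S≡S′
... | inj₂ S⊂S′ = contradiction (Subset.p⊂q⇒∣p∣<∣q∣ S⊂S′) (ℕ.<-irrefl eq)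

module Geometry (X : SimplicialSurface) where
  open SimplicialSurface X
  open Graph (faceGraph X) using () renaming (_≟_ to _≟ᶠ_; finite to faces-finite) public

  Simplex-≡ : ∀ {i} {S S′ : Simplex i} → proj₁ S ≡ proj₁ S′ → S ≡ S′
  Simplex-≡ {S = S , p , q} {.S , p′ , q′} refl =
    cong₂ (λ p q → S , p , q) (Bool.T-irrelevant p p′) (ℕ.≡-irrelevant q q′)

  opaque

    vertex-point : (v : Vertex) → Σ[ i ∈ Fin size ] i ∈ˢ proj₁ v × (∀ {j} → j ∈ˢ proj₁ v → j ≡ i)
    vertex-point (S , _ , ∣S∣≡1) with HasSize-∈ S
    ... | xs , len , in-S , _ , all with xs | trans len ∣S∣≡1
    ... | i ∷ [] | refl = i , All.head in-S , λ j∈S → [ id , (λ ()) ]′ (Any.toSum (all _ j∈S))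

  point : Vertex → Fin size
  point v = proj₁ (vertex-point v)

  point-∈ : ∀ v → point v ∈ˢ proj₁ v
  point-∈ v = proj₁ (proj₂ (vertex-point v))

  point-only : ∀ v {j} → j ∈ˢ proj₁ v → j ≡ point v
  point-only v = proj₂ (proj₂ (vertex-point v))

  point-⊆ : ∀ v {S} → point v ∈ˢ S → proj₁ v ⊆ S
  point-⊆ v {S} p∈S j∈v = subst (_∈ˢ S) (sym (point-only v j∈v)) p∈S

  point-injective : ∀ {v w} → point v ≡ point w → v ≡ w
  point-injective {v} {w} eq = Simplex-≡ (Subset.⊆-antisym
    (point-⊆ v (subst (_∈ˢ proj₁ w) (sym eq) (point-∈ w)))
    (point-⊆ w (subst (_∈ˢ proj₁ v) eq (point-∈ v))))

  opaque

    vertexAt : ∀ {S i} → T (member S) → i ∈ˢ S → ∃[ v ] point v ≡ i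
    vertexAt {S} {i} S∈X i∈S = v , sym (point-only v (Subset.x∈⁅x⁆ i))
      where
      v : Vertex
      v = ⁅ i ⁆ ,
          closed (λ j∈ → subst (_∈ˢ S) (sym (Subset.x∈⁅y⁆⇒x≡y i j∈)) i∈S) S∈X ,
          Subset.∣⁅x⁆∣≡1 i

    _≟ᵛ_ : DecidableEquality Vertex
    v ≟ᵛ w = map′ point-injective (cong point) (point v Fin.≟ point w)

  infix 4 _∈ᶠ_ _∈ᶠ?_

  -- Equivalent to `v ≼ F`. That relation unfolds to an inclusion of subsets, from which `v` and `F`
  -- cannot be inferred; a record keeps them visible.
  record _∈ᶠ_ (v : Vertex) (F : Face) : Set where
    constructor ∈ᶠ-intro
    field point∈ : point v ∈ˢ proj₁ F

  open _∈ᶠ_ public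

  opaque

    _∈ᶠ?_ : ∀ v F → Dec (v ∈ᶠ F)
    v ∈ᶠ? F = map′ ∈ᶠ-intro point∈ (point v Subset.∈? proj₁ F)

    ≼⇒∈ᶠ : ∀ {v F} → v ≼ F → v ∈ᶠ F
    ≼⇒∈ᶠ {v} v≼F = ∈ᶠ-intro (v≼F (point-∈ v))

    ∈ᶠ⇒≼ : ∀ {v F} → v ∈ᶠ F → v ≼ F
    ∈ᶠ⇒≼ {v} (∈ᶠ-intro p∈F) = point-⊆ v p∈F

    HasSize-∈ᶠ : ∀ F → HasSize _≡_ (_∈ᶠ F) 3
    HasSize-∈ᶠ F@(S , S∈X , ∣S∣≡3) = subst (HasSize _≡_ (_∈ᶠ F)) ∣S∣≡3
      (HasSize-map
        (λ i i∈S → proj₁ (vertexAt S∈X i∈S))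
        (λ i i∈S → ∈ᶠ-intro (subst (_∈ˢ S) (sym (proj₂ (vertexAt S∈X i∈S))) i∈S))
        (λ {i} {j} {i∈S} {j∈S} eq → trans (sym (proj₂ (vertexAt S∈X i∈S)))
          (trans (cong point eq) (proj₂ (vertexAt S∈X j∈S))))
        (λ { v (∈ᶠ-intro p∈S) → point v , p∈S ,
             λ { _ p′ refl → point-injective (sym (proj₂ (vertexAt S∈X p′))) } })
        (HasSize-∈ S))

  record Triangle (a b c : Vertex) (F : Face) : Set where
    field
      a≢b : a ≢ b
      a≢c : a ≢ c
      b≢c : b ≢ c
      a∈F : a ∈ᶠ F
      b∈F : b ∈ᶠ F
      c∈F : c ∈ᶠ F
      only : ∀ {v} → v ∈ᶠ F → v ≡ a ⊎ v ≡ b ⊎ v ≡ c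

    third : ∀ {v} → v ∈ᶠ F → v ≢ a → v ≢ b → v ≡ c
    third v∈F v≢a v≢b with only v∈F
    ... | inj₁ v≡a        = contradiction v≡a v≢a
    ... | inj₂ (inj₁ v≡b) = contradiction v≡b v≢b
    ... | inj₂ (inj₂ v≡c) = v≡c

  module _ {a b c F} (t : Triangle a b c F) where
    open Triangle t

    rotate-triangle : Triangle b c a F
    rotate-triangle = record
      { a≢b = b≢c ; a≢c = a≢b ∘ sym ; b≢c = a≢c ∘ sym
      ; a∈F = b∈F ; b∈F = c∈F ; c∈F = a∈F
      ; only = λ v∈F → [ inj₂ ∘ inj₂ , [ inj₁ , inj₂ ∘ inj₁ ]′ ]′ (only v∈F)
      }

    swap-triangle : Triangle a c b F
    swap-triangle = record
      { a≢b = a≢c ; a≢c = a≢b ; b≢c = b≢c ∘ sym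
      ; a∈F = a∈F ; b∈F = c∈F ; c∈F = b∈F
      ; only = λ v∈F → [ inj₁ , [ inj₂ ∘ inj₂ , inj₂ ∘ inj₁ ]′ ]′ (only v∈F)
      }

  opaque

    triangle : ∀ F → ∃[ a ] ∃[ b ] ∃[ c ] Triangle a b c F
    triangle F with HasSize-∈ᶠ F
    ... | a ∷ b ∷ c ∷ [] , _ , a∈ ∷ b∈ ∷ c∈ ∷ [] ,
          (a≢b ∷ a≢c ∷ []) ∷ (b≢c ∷ []) ∷ [] ∷ [] , all =
      a , b , c , record
        { a≢b = a≢b ; a≢c = a≢c ; b≢c = b≢c ; a∈F = a∈ ; b∈F = b∈ ; c∈F = c∈
        ; only = λ v∈F → cases (all _ v∈F)
        }
      where
      cases : ∀ {v} → Any (v ≡_) (a ∷ b ∷ c ∷ []) → v ≡ a ⊎ v ≡ b ⊎ v ≡ c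
      cases (here eq)                 = inj₁ eq
      cases (there (here eq))         = inj₂ (inj₁ eq)
      cases (there (there (here eq))) = inj₂ (inj₂ eq)

    triangle-at : ∀ {a F} → a ∈ᶠ F → ∃[ b ] ∃[ c ] Triangle a b c F
    triangle-at {a} {F} a∈F with x , y , z , t ← triangle F | Triangle.only t a∈F
    ... | inj₁ refl        = y , z , t
    ... | inj₂ (inj₁ refl) = z , x , rotate-triangle t
    ... | inj₂ (inj₂ refl) = x , y , rotate-triangle (rotate-triangle t)

    triangle-at₂ : ∀ {a b F} → a ≢ b → a ∈ᶠ F → b ∈ᶠ F → ∃[ c ] Triangle a b c F
    triangle-at₂ a≢b a∈F b∈F with y , z , t ← triangle-at a∈F | Triangle.only t b∈F
    ... | inj₁ b≡a         = contradiction (sym b≡a) a≢b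
    ... | inj₂ (inj₁ refl) = z , t
    ... | inj₂ (inj₂ refl) = y , swap-triangle t

    Face-≡ : ∀ {a b c F G} → Triangle a b c F → a ∈ᶠ G → b ∈ᶠ G → c ∈ᶠ G → F ≡ G
    Face-≡ {F = F} {G} t a∈G b∈G c∈G = Simplex-≡
      (⊆∧∣∣≡⇒≡ F⊆G (trans (proj₂ (proj₂ F)) (sym (proj₂ (proj₂ G)))))
      where
      F⊆G : proj₁ F ⊆ proj₁ G
      F⊆G i∈F with v , refl ← vertexAt (proj₁ (proj₂ F)) i∈F
        with Triangle.only t {v} (∈ᶠ-intro i∈F)
      ... | inj₁ refl        = point∈ a∈G
      ... | inj₂ (inj₁ refl) = point∈ b∈G
      ... | inj₂ (inj₂ refl) = point∈ c∈G

  -- Faces across an edge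

  record Across (F : Face) (b c : Vertex) (G : Face) : Set where
    field
      F≢G : F ≢ G
      b≢c : b ≢ c
      b∈F : b ∈ᶠ F
      c∈F : c ∈ᶠ F
      b∈G : b ∈ᶠ G
      c∈G : c ∈ᶠ G

  module _ {F b c G} (x : Across F b c G) where
    open Across x

    across-sym : Across G b c F
    across-sym = record
      { F≢G = F≢G ∘ sym ; b≢c = b≢c ; b∈F = b∈G ; c∈F = c∈G ; b∈G = b∈F ; c∈G = c∈F }

    across-swap : Across F c b G
    across-swap = record
      { F≢G = F≢G ; b≢c = b≢c ∘ sym ; b∈F = c∈F ; c∈F = b∈F ; b∈G = c∈G ; c∈G = b∈G }

    -- A further common vertex would give `F` and `G` three vertices in common and make them equal.
    across-common : ∀ {v} → v ∈ᶠ F → v ∈ᶠ G → v ≡ b ⊎ v ≡ c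
    across-common {v} v∈F v∈G with d , t ← triangle-at₂ b≢c b∈F c∈F | Triangle.only t v∈F
    ... | inj₁ v≡b         = inj₁ v≡b
    ... | inj₂ (inj₁ v≡c)  = inj₂ v≡c
    ... | inj₂ (inj₂ refl) = contradiction (Face-≡ t b∈G c∈G v∈G) F≢G

  opaque

    edgeOn : ∀ {b c F} → b ≢ c → b ∈ᶠ F → c ∈ᶠ F →
      Σ[ e ∈ Edge ] point b ∈ˢ proj₁ e × point c ∈ˢ proj₁ e ×
        (∀ {G} → b ∈ᶠ G → c ∈ᶠ G → e ≼ G)
    edgeOn {b} {c} {F} b≢c b∈F c∈F =
      (S , closed (S⊆ b∈F c∈F) (proj₁ (proj₂ F)) , ∣S∣≡2) , b∈S , c∈S , λ b∈G c∈G {_} → S⊆ b∈G c∈G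
      where
      S : Subset size
      S = ⁅ point b ⁆ ∪ ⁅ point c ⁆

      b∈S : point b ∈ˢ S
      b∈S = Subset.x∈p∪q⁺ (inj₁ (Subset.x∈⁅x⁆ _))

      c∈S : point c ∈ˢ S
      c∈S = Subset.x∈p∪q⁺ (inj₂ (Subset.x∈⁅x⁆ _))

      S-only : ∀ {i} → i ∈ˢ S → i ≡ point b ⊎ i ≡ point c
      S-only i∈S with Subset.x∈p∪q⁻ ⁅ point b ⁆ ⁅ point c ⁆ i∈S
      ... | inj₁ i∈b = inj₁ (Subset.x∈⁅y⁆⇒x≡y _ i∈b)
      ... | inj₂ i∈c = inj₂ (Subset.x∈⁅y⁆⇒x≡y _ i∈c)

      S⊆ : ∀ {G : Face} → b ∈ᶠ G → c ∈ᶠ G → S ⊆ proj₁ G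
      S⊆ b∈G c∈G i∈S with S-only i∈S
      ... | inj₁ refl = point∈ b∈G
      ... | inj₂ refl = point∈ c∈G

      ∣S∣≡2 : ∣ S ∣ ≡ 2
      ∣S∣≡2 = HasSize-unique isEquivalence (HasSize-∈ S)
        (HasSize-pair (point b) (point c) b∈S c∈S (b≢c ∘ point-injective) (λ _ → S-only))

    -- All of `F`, `G` and `G′` contain the edge spanned by `b` and `c`, but only two faces do.
    across-unique : ∀ {F b c G G′} → Across F b c G → Across F b c G′ → G ≡ G′
    across-unique {F} {b} {c} {G} {G′} x x′
      with e , b∈e , c∈e , e≼ ← edgeOn (Across.b≢c x) (Across.b∈F x) (Across.c∈F x)
      with edge-in-two-faces e | G ≟ᶠ G′
    ... | _ | yes G≡G′ = G≡G′
    ... | _ , two , _ , _ , all | no G≢G′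
      with s≤s (s≤s ()) ← subst (3 ≤_) two (pigeonhole isEquivalence
             ((Across.F≢G x ∷ Across.F≢G x′ ∷ []) ∷ (G≢G′ ∷ []) ∷ [] ∷ [])
             λ { (here refl)                 → all F (e≼ (Across.b∈F x) (Across.c∈F x))
               ; (there (here refl))         → all G (e≼ (Across.b∈G x) (Across.c∈G x))
               ; (there (there (here refl))) → all G′ (e≼ (Across.b∈G x′) (Across.c∈G x′)) })

    across : ∀ {b c} F → b ≢ c → b ∈ᶠ F → c ∈ᶠ F → ∃[ G ] Across F b c G
    across {b} {c} F b≢c b∈F c∈F
      with e , b∈e , c∈e , _ ← edgeOn b≢c b∈F c∈F
      with edge-in-two-faces e
    ... | P ∷ Q ∷ [] , _ , e≼P ∷ e≼Q ∷ [] , (P≢Q ∷ []) ∷ [] ∷ [] , _ with F ≟ᶠ P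
    ... | yes refl = Q , record
      { F≢G = P≢Q ; b≢c = b≢c ; b∈F = b∈F ; c∈F = c∈F
      ; b∈G = ∈ᶠ-intro (e≼Q b∈e) ; c∈G = ∈ᶠ-intro (e≼Q c∈e) }
    ... | no F≢P = P , record
      { F≢G = F≢P ; b≢c = b≢c ; b∈F = b∈F ; c∈F = c∈F
      ; b∈G = ∈ᶠ-intro (e≼P b∈e) ; c∈G = ∈ᶠ-intro (e≼P c∈e) }

    two-points : ∀ {S : Subset size} → T (member S) → ∣ S ∣ ≡ 2 →
      ∃[ b ] ∃[ c ] b ≢ c × point b ∈ˢ S × point c ∈ˢ S
    two-points {S} S∈X ∣S∣≡2 with HasSize-∈ S
    ... | xs , len , in-S , xs! , _ with xs | trans len ∣S∣≡2 | in-S | xs!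
    ... | i ∷ j ∷ [] | refl | i∈S ∷ j∈S ∷ [] | (i≢j ∷ []) ∷ _
      with b , refl ← vertexAt S∈X i∈S | c , refl ← vertexAt S∈X j∈S =
      b , c , (λ b≡c → i≢j (cong point b≡c)) , i∈S , j∈S

    FaceAdj⇒Across : ∀ {F G} → FaceAdj X F G → ∃[ b ] ∃[ c ] Across F b c G
    FaceAdj⇒Across (F≢G , (S , S∈X , ∣S∣≡2) , e≼F , e≼G)
      with b , c , b≢c , b∈S , c∈S ← two-points S∈X ∣S∣≡2 = b , c , record
      { F≢G = F≢G ; b≢c = b≢c
      ; b∈F = ∈ᶠ-intro (e≼F b∈S) ; c∈F = ∈ᶠ-intro (e≼F c∈S)
      ; b∈G = ∈ᶠ-intro (e≼G b∈S) ; c∈G = ∈ᶠ-intro (e≼G c∈S) }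

    Across⇒FaceAdj : ∀ {F b c G} → Across F b c G → FaceAdj X F G
    Across⇒FaceAdj {F} {b} {c} {G} x =
      F≢G , proj₁ edge , proj₂ (proj₂ (proj₂ edge)) b∈F c∈F , proj₂ (proj₂ (proj₂ edge)) b∈G c∈G
      where
      open Across x
      edge : Σ[ e ∈ Edge ] point b ∈ˢ proj₁ e × point c ∈ˢ proj₁ e ×
        (∀ {G} → b ∈ᶠ G → c ∈ᶠ G → e ≼ G)
      edge = edgeOn b≢c b∈F c∈F

  Meet : Face → Face → Set
  Meet F G = ∣ proj₁ F ∩ proj₁ G ∣ ≡ 2

  opaque

    -- The intersection is a simplex, being contained in `F`, and its two points are the ends of the
    -- common edge.
    Meet⇒Across : ∀ {F G} → Meet F G → ∃[ b ] ∃[ c ] Across F b c G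
    Meet⇒Across {F} {G} ∣F∩G∣≡2
      with b , c , b≢c , b∈∩ , c∈∩ ← two-points
             (closed (Subset.p∩q⊆p (proj₁ F) (proj₁ G)) (proj₁ (proj₂ F))) ∣F∩G∣≡2 =
      b , c , record
      { F≢G = λ { refl → contradiction
          (trans (sym (trans (cong ∣_∣ (Subset.∩-idem (proj₁ F))) (proj₂ (proj₂ F)))) ∣F∩G∣≡2)
          λ () }
      ; b≢c = b≢c
      ; b∈F = ∈ᶠ-intro (Subset.p∩q⊆p _ _ b∈∩) ; c∈F = ∈ᶠ-intro (Subset.p∩q⊆p _ _ c∈∩)
      ; b∈G = ∈ᶠ-intro (Subset.p∩q⊆q (proj₁ F) _ b∈∩) ; c∈G = ∈ᶠ-intro (Subset.p∩q⊆q (proj₁ F) _ c∈∩) }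

    -- A strict enlargement raises the cardinality, which never exceeds `size`; the fuel `k` bounds
    -- the number of enlargements still possible.
    maximal-above : ∀ S → T (member S) → ∃[ M ] Maximal M × S ⊆ M
    maximal-above S = search size S (ℕ.m≤m+n size ∣ S ∣)
      where
      search : ∀ k S → size ≤ k + ∣ S ∣ → T (member S) → ∃[ M ] Maximal M × S ⊆ M
      search k S bound S∈X
        with Subset.anySubset? (λ S′ → T? (member S′) ×-dec (S Subset.⊂? S′))
      ... | no none = S , (S∈X , maximal) , Subset.⊆-refl
        where
        maximal : ∀ S′ → T (member S′) → S ⊆ S′ → S ≡ S′
        maximal S′ S′∈X S⊆S′ with ⊆⇒≡⊎⊂ S⊆S′
        ... | inj₁ S≡S′ = S≡S′
        ... | inj₂ S⊂S′ = contradiction (S′ , S′∈X , S⊂S′) none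
      search zero S bound S∈X | yes (S′ , _ , S⊂S′) = contradiction
        (ℕ.<-≤-trans (Subset.p⊂q⇒∣p∣<∣q∣ S⊂S′) (ℕ.≤-trans (Subset.∣p∣≤n S′) bound)) (ℕ.<-irrefl refl)
      search (suc k) S bound S∈X | yes (S′ , S′∈X , S⊂S′)
        with M , max , S′⊆M ← search k S′
               (ℕ.≤-trans bound (subst (_≤ k + ∣ S′ ∣) (ℕ.+-suc k ∣ S ∣)
                 (ℕ.+-monoʳ-≤ k (Subset.p⊂q⇒∣p∣<∣q∣ S⊂S′)))) S′∈X =
        M , max , Subset.⊆-trans (Subset.p⊂q⇒p⊆q S⊂S′) S′⊆M

    face-above : ∀ S → T (member S) → Σ[ F ∈ Face ] S ⊆ proj₁ F
    face-above S S∈X with M , max , S⊆M ← maximal-above S S∈X =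
      (M , proj₁ max , pure M max) , S⊆M

    some-face : Face
    some-face = proj₁ (face-above (proj₁ nonempty) (proj₂ nonempty))

    face-at : ∀ v → ∃[ F ] v ∈ᶠ F
    face-at v@(S , S∈X , _) with F , S⊆F ← face-above S S∈X = F , ≼⇒∈ᶠ {v} {F} S⊆F

    -- For v ≢ w in a face F with third vertex x, the face across {v, x} avoids w.
    vertex-determined : ∀ {v w} → (∀ {F} → v ∈ᶠ F → w ∈ᶠ F) → v ≡ w
    vertex-determined {v} {w} v⇒w with v ≟ᵛ w
    ... | yes v≡w = v≡w
    ... | no  v≢w with F , v∈F ← face-at v
      with x , t ← triangle-at₂ v≢w v∈F (v⇒w v∈F)
      with G , y ← across F (Triangle.a≢c t) v∈F (Triangle.c∈F t) =
      contradiction (Face-≡ t (Across.b∈G y) (v⇒w (Across.b∈G y)) (Across.c∈G y)) (Across.F≢G y)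

-- Umbrellas

module _ {A : Set} {R : Rel A 0ℓ} where

  Linked-++⁻ˡ : ∀ xs {ys} → Linked R (xs ++ ys) → Linked R xs
  Linked-++⁻ˡ []           l       = []
  Linked-++⁻ˡ (x ∷ [])     l       = [-]
  Linked-++⁻ˡ (x ∷ y ∷ xs) (r ∷ l) = r ∷ Linked-++⁻ˡ (y ∷ xs) l

  Linked-++⁻ʳ : ∀ xs {ys} → Linked R (xs ++ ys) → Linked R ys
  Linked-++⁻ʳ []       l = l
  Linked-++⁻ʳ (x ∷ xs) l = Linked-++⁻ʳ xs (Linked.tail l)

  Linked-map-All : {P : Pred A 0ℓ} {S : Rel A 0ℓ} → (∀ {x y} → P x → P y → R x y → S x y) →
    ∀ {xs} → All P xs → Linked R xs → Linked S xs
  Linked-map-All f []           []      = []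
  Linked-map-All f (p ∷ [])     [-]     = [-]
  Linked-map-All f (p ∷ q ∷ ps) (r ∷ l) = f p q r ∷ Linked-map-All f (q ∷ ps) l

module _ {A : Set} (_≟_ : DecidableEquality A) {R : Rel A 0ℓ} (R-sym : Symmetric R)
  (degree-two : ∀ {x y₁ y₂ y₃} → R x y₁ → R x y₂ → R x y₃ → y₁ ≢ y₂ → y₁ ≢ y₃ → y₂ ≡ y₃)
  where

  private
    Rotates : Rel (List A) 0ℓ
    Rotates c d = ∃[ xs ] ∃[ ys ] c ≡ xs ++ ys × d ≡ ys ++ xs

  -- Rotate the cycle to start at x; the two neighbours of x are then the second
  -- and the last entry, and in the latter case the reversed cycle is used.
  rotate-to-arc : ∀ {x y} xs ys → R x y → 3 ≤ length (x ∷ ys ++ xs) →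
    Unique (x ∷ ys ++ xs) → CyclicallyLinked R (x ∷ ys ++ xs) →
    let c = xs ++ x ∷ ys in
    ∃[ zs ] (Rotates c (x ∷ y ∷ zs) ⊎ Rotates (reverse c) (x ∷ y ∷ zs))
  rotate-to-arc {x} {y} xs ys x-y = start (ys ++ xs) refl
    where
    reversed : reverse (xs ++ x ∷ ys) ≡ reverse ys ++ x ∷ reverse xs
    reversed = trans (List.reverse-++ xs (x ∷ ys))
      (trans (cong (_++ reverse xs) (List.unfold-reverse x ys))
             (List.++-assoc (reverse ys) (x ∷ []) (reverse xs)))

    start : ∀ zs → ys ++ xs ≡ zs → 3 ≤ length (x ∷ zs) → Unique (x ∷ zs) →
      CyclicallyLinked R (x ∷ zs) →
      ∃[ ws ] (Rotates (xs ++ x ∷ ys) (x ∷ y ∷ ws) ⊎ Rotates (reverse (xs ++ x ∷ ys)) (x ∷ y ∷ ws))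
    start []       eq (s≤s ()) _ _
    start (z ∷ zs) eq len u l with z ≟ y | initLast zs
    ... | yes refl | _ = zs , inj₁ (xs , x ∷ ys , refl , cong (x ∷_) (sym eq))
    start (z ∷ .[]) eq (s≤s (s≤s ())) u l | no _ | []
    start (z ∷ .(ws ++ w ∷ [])) eq _ (_ ∷ z∉ ∷ _) l | no z≢y | ws ∷ʳ′ w
      with refl ← degree-two (Linked.head l) x-y
                    (R-sym (Linked.head (Linked-++⁻ʳ (x ∷ z ∷ ws)
                      (subst (λ zs → Linked R (x ∷ z ∷ zs))
                        (List.++-assoc ws (w ∷ []) (x ∷ [])) l))))
                    z≢y (All.lookup z∉ (∈-++⁺ʳ ws (here refl))) =
      reverse ws ++ z ∷ [] ,
      inj₂ (reverse ys , x ∷ reverse xs , reversed ,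
            cong (x ∷_) (sym (trans (sym (List.reverse-++ ys xs)) (trans (cong reverse eq)
              (trans (List.unfold-reverse z (ws ++ w ∷ []))
                     (cong (_++ z ∷ []) (List.reverse-++ ws (w ∷ []))))))))

  -- A walk that never turns back has only one way on at each node, so its first two nodes fix it.
  Linked-determined : ∀ {x y} zs ws →
    Linked R (x ∷ y ∷ zs) → Linked R (x ∷ y ∷ ws) →
    Unique (x ∷ y ∷ zs) → Unique (x ∷ y ∷ ws) → length zs ≡ length ws → zs ≡ ws
  Linked-determined []       []       _ _ _ _ _ = refl
  Linked-determined (z ∷ zs) (w ∷ ws) (p ∷ q ∷ l) (_ ∷ q′ ∷ l′)
    ((_ ∷ x≢z ∷ _) ∷ zs!) ((_ ∷ x≢w ∷ _) ∷ ws!) eq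
    with refl ← degree-two (R-sym p) q q′ x≢z x≢w =
    cong (z ∷_) (Linked-determined zs ws (q ∷ l) (q′ ∷ l′) zs! ws! (ℕ.suc-injective eq))

module Umbrellas (X : SimplicialSurface) where
  open SimplicialSurface X
  open Geometry X

  AdjacentAt : Vertex → Face → Face → Set
  AdjacentAt v F G = ∃[ x ] Across F v x G

  opaque

    adjacentAt : ∀ {v b c F G} → v ∈ᶠ F → v ∈ᶠ G → Across F b c G → AdjacentAt v F G
    adjacentAt v∈F v∈G x with across-common x v∈F v∈G
    ... | inj₁ refl = _ , x
    ... | inj₂ refl = _ , across-swap x

    adjacentAt-sym : ∀ {v} → Symmetric (AdjacentAt v)
    adjacentAt-sym (_ , x) = _ , across-sym x

    -- Besides `v` the face `F` has two vertices, hence two edges through `v`, and each leads to one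
    -- further face.
    degree-two : ∀ {v F G₁ G₂ G₃} →
      AdjacentAt v F G₁ → AdjacentAt v F G₂ → AdjacentAt v F G₃ →
      G₁ ≢ G₂ → G₁ ≢ G₃ → G₂ ≡ G₃
    degree-two (x , p) (y , q) (z , r) G₁≢G₂ G₁≢G₃
      with _ , t ← triangle-at₂ (Across.b≢c p) (Across.b∈F p) (Across.c∈F p)
      with refl ← Triangle.third t (Across.c∈F q) (Across.b≢c q ∘ sym)
                    (λ { refl → G₁≢G₂ (across-unique p q) })
         | refl ← Triangle.third t (Across.c∈F r) (Across.b≢c r ∘ sym)
                    (λ { refl → G₁≢G₃ (across-unique p r) }) =
      across-unique q r

  -- Two faces at `v` that meet in two vertices share an edge through `v`; so `linked` can use
  -- `AdjacentAt v`, the relation for which `degree-two` holds.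
  record Umbrella (v : Vertex) (c : List Face) : Set where
    field
      unique   : Unique c
      sound    : All (v ∈ᶠ_) c
      complete : ∀ {F} → v ∈ᶠ F → F ∈ c
      linked   : CyclicallyLinked (AdjacentAt v) c

  open Umbrella public

  opaque

    umbrella-Umbrella : ∀ v → Umbrella v (umbrella v)
    umbrella-Umbrella v with u! , spec , l ← isUmbrella v = record
      { unique   = u!
      ; sound    = all
      ; complete = λ {F} v∈F → Equivalence.from (spec F) (∈ᶠ⇒≼ {v} {F} v∈F)
      ; linked   = Linked-map-All
          (λ {F} {G} v∈F v∈G F∩G → adjacentAt v∈F v∈G (proj₂ (proj₂ (Meet⇒Across {F} {G} F∩G))))
          (All.++⁺ all (All.take⁺ 1 all)) l
      }
      where
      all : All (v ∈ᶠ_) (umbrella v)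
      all = All.tabulate λ {F} F∈ → ≼⇒∈ᶠ {v} {F} (Equivalence.to (proj₁ (proj₂ (isUmbrella v)) F) F∈)

    Umbrella-rotate : ∀ {v} c → Umbrella v c → Umbrella v (rotate c)
    Umbrella-rotate c u = record
      { unique   = Unique-rotate c (unique u)
      ; sound    = All-rotate c (sound u)
      ; complete = λ v∈F → ∈-rotate c (complete u v∈F)
      ; linked   = CyclicallyLinked-rotate c (linked u)
      }
      where
      ∈-rotate : ∀ (c : List Face) {F} → F ∈ c → F ∈ rotate c
      ∈-rotate (_ ∷ xs) (here eq)  = ∈-++⁺ʳ xs (here eq)
      ∈-rotate (_ ∷ xs) (there i) = ∈-++⁺ˡ i

    Umbrella-rotateBy : ∀ {v} n c → Umbrella v c → Umbrella v (rotateBy n c)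
    Umbrella-rotateBy = rotateBy-resp (Umbrella _) Umbrella-rotate

    Umbrella-reverse : ∀ {v c} → Umbrella v c → Umbrella v (reverse c)
    Umbrella-reverse {c = c} u = record
      { unique   = Unique-reverse (unique u)
      ; sound    = All.tabulate (All.lookup (sound u) ∘ Any.reverse⁻)
      ; complete = Any.reverse⁺ ∘ complete u
      ; linked   = CyclicallyLinked-reverse adjacentAt-sym c (linked u)
      }

  infix 4 _∼_
  _∼_ : List Face → List Face → Set
  _∼_ = _≈ᶜ_ (faceGraph X)

  opaque

    Umbrella-resp-Rotation : ∀ {v c d} → Rotation (faceGraph X) c d → Umbrella v c → Umbrella v d
    Umbrella-resp-Rotation (xs , ys , refl , refl) u =
      subst (Umbrella _) (rotateBy-++ xs ys) (Umbrella-rotateBy (length xs) _ u)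

    Umbrella-resp-∼ : ∀ {v c d} → c ∼ d → Umbrella v c → Umbrella v d
    Umbrella-resp-∼ (inj₁ r) u = Umbrella-resp-Rotation r u
    Umbrella-resp-∼ (inj₂ r) u = Umbrella-resp-Rotation r (Umbrella-reverse u)

    HasSize-umbrella : ∀ {v c} → Umbrella v c → HasSize _≡_ (v ∈ᶠ_) (length c)
    HasSize-umbrella u = _ , refl , sound u , unique u , λ _ → complete u

    -- A face at `v` and its neighbours across its two edges through `v` are distinct: if the
    -- neighbours coincided, they would contain all its vertices.
    umbrella-length : ∀ {v c} → Umbrella v c → 3 ≤ length c
    umbrella-length {v} u with F , v∈F ← face-at v
      with x , y , t ← triangle-at v∈F
      with G , p ← across F (Triangle.a≢b t) v∈F (Triangle.b∈F t)
         | H , q ← across F (Triangle.a≢c t) v∈F (Triangle.c∈F t) =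
      pigeonhole isEquivalence
        ((Across.F≢G p ∷ Across.F≢G q ∷ []) ∷ (G≢H ∷ []) ∷ [] ∷ [])
        λ { (here refl)                 → complete u v∈F
          ; (there (here refl))         → complete u (Across.b∈G p)
          ; (there (there (here refl))) → complete u (Across.b∈G q) }
      where
      G≢H : G ≢ H
      G≢H refl = Across.F≢G p (Face-≡ t (Across.b∈G p) (Across.c∈G p) (Across.c∈G q))

    -- Adjacent faces at `v` are consecutive in the umbrella; this is the source of chordlessness.
    umbrella-through : ∀ {v c F G} → Umbrella v c → AdjacentAt v F G → ∃[ zs ] c ∼ F ∷ G ∷ zs
    umbrella-through {v} {c} {F} {G} u F-G@(_ , x)
      with xs , ys , refl ← ∈-∃++ (complete u (Across.b∈F x)) =
      rotate-to-arc _≟ᶠ_ adjacentAt-sym degree-two xs ys F-G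
        (umbrella-length u′) (unique u′) (linked u′)
      where
      u′ : Umbrella v (F ∷ ys ++ xs)
      u′ = Umbrella-resp-Rotation (xs , F ∷ ys , refl , refl) u

    -- Turned so as to start with the first two faces of `d`, the list `c` is forced from there on;
    -- the lengths agree because both count the faces at `v`.
    umbrella-unique : ∀ {v c d} → Umbrella v c → Umbrella v d → c ∼ d
    umbrella-unique {v} {c} {d} u u′ with d | u′ | umbrella-length u′
    ... | _ ∷ []     | _  | s≤s ()
    ... | F ∷ G ∷ ds | u′ | _ with zs , c∼ ← umbrella-through u (Linked.head (linked u′)) =
      subst (λ ws → c ∼ F ∷ G ∷ ws)
        (Linked-determined _≟ᶠ_ adjacentAt-sym degree-two zs ds
          (Linked-++⁻ˡ (F ∷ G ∷ zs) (linked u″)) (Linked-++⁻ˡ (F ∷ G ∷ ds) (linked u′))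
          (unique u″) (unique u′)
          (ℕ.suc-injective (ℕ.suc-injective
            (HasSize-unique isEquivalence (HasSize-umbrella u″) (HasSize-umbrella u′)))))
        c∼
      where
      u″ : Umbrella v (F ∷ G ∷ zs)
      u″ = Umbrella-resp-∼ c∼ u

    umbrella-vertex-unique : ∀ {v w c} → Umbrella v c → Umbrella w c → v ≡ w
    umbrella-vertex-unique u u′ = vertex-determined (All.lookup (sound u′) ∘ complete u)

-- Automorphisms

module Automorphisms (X : SimplicialSurface) where
  open SimplicialSurface X
  open Geometry X

  -- The induced permutation of the faces is carried as data, so that one object stands for an
  -- automorphism of `X` and for its image under λ; each permutation determines the other.
  record Automorphism : Set where
    field
      vperm : Vertex ↔ Vertex
      fperm : Face ↔ Face

    vmap : Vertex → Vertex
    vmap = Inverse.to vperm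

    fmap : Face → Face
    fmap = Inverse.to fperm

    field
      incidence⁺ : ∀ {v F} → v ∈ᶠ F → vmap v ∈ᶠ fmap F
      incidence⁻ : ∀ {v F} → vmap v ∈ᶠ fmap F → v ∈ᶠ F

    vmap-injective : ∀ {v w} → vmap v ≡ vmap w → v ≡ w
    vmap-injective eq = trans (sym (Inverse.strictlyInverseʳ vperm _))
      (trans (cong (Inverse.from vperm) eq) (Inverse.strictlyInverseʳ vperm _))

    fmap-injective : ∀ {F G} → fmap F ≡ fmap G → F ≡ G
    fmap-injective eq = trans (sym (Inverse.strictlyInverseʳ fperm _))
      (trans (cong (Inverse.from fperm) eq) (Inverse.strictlyInverseʳ fperm _))

    across-map : ∀ {F b c G} → Across F b c G → Across (fmap F) (vmap b) (vmap c) (fmap G)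
    across-map x = record
      { F≢G = F≢G ∘ fmap-injective ; b≢c = b≢c ∘ vmap-injective
      ; b∈F = incidence⁺ b∈F ; c∈F = incidence⁺ c∈F
      ; b∈G = incidence⁺ b∈G ; c∈G = incidence⁺ c∈G }
      where open Across x

    FaceAdj-map : ∀ {F G} → FaceAdj X F G → FaceAdj X (fmap F) (fmap G)
    FaceAdj-map adj = Across⇒FaceAdj (across-map (proj₂ (proj₂ (FaceAdj⇒Across adj))))

  open Automorphism public

  infixr 9 _⊙_
  infix 10 _⁻

  identity : Automorphism
  identity = record
    { vperm = ↔-id _ ; fperm = ↔-id _ ; incidence⁺ = id ; incidence⁻ = id }

  _⊙_ : Automorphism → Automorphism → Automorphism
  g ⊙ h = record
    { vperm = vperm g ↔-∘ vperm h ; fperm = fperm g ↔-∘ fperm h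
    ; incidence⁺ = incidence⁺ g ∘ incidence⁺ h ; incidence⁻ = incidence⁻ h ∘ incidence⁻ g }

  _⁻ : Automorphism → Automorphism
  g ⁻ = record
    { vperm = ↔-sym (vperm g) ; fperm = ↔-sym (fperm g)
    ; incidence⁺ = λ {v} {F} v∈F → incidence⁻ g (subst₂ _∈ᶠ_
        (sym (Inverse.strictlyInverseˡ (vperm g) v))
        (sym (Inverse.strictlyInverseˡ (fperm g) F)) v∈F)
    ; incidence⁻ = λ {v} {F} v∈F → subst₂ _∈ᶠ_
        (Inverse.strictlyInverseˡ (vperm g) v) (Inverse.strictlyInverseˡ (fperm g) F)
        (incidence⁺ g v∈F) }

  vmap-⁻ʳ : ∀ g v → vmap g (vmap (g ⁻) v) ≡ v
  vmap-⁻ʳ g = Inverse.strictlyInverseˡ (vperm g)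

  vmap-⁻ˡ : ∀ g v → vmap (g ⁻) (vmap g v) ≡ v
  vmap-⁻ˡ g = Inverse.strictlyInverseʳ (vperm g)

  fmap-⁻ʳ : ∀ g F → fmap g (fmap (g ⁻) F) ≡ F
  fmap-⁻ʳ g = Inverse.strictlyInverseˡ (fperm g)

  fmap-⁻ˡ : ∀ g F → fmap (g ⁻) (fmap g F) ≡ F
  fmap-⁻ˡ g = Inverse.strictlyInverseʳ (fperm g)

  FaceAdj-map⁻ : ∀ g {F G} → FaceAdj X (fmap g F) (fmap g G) → FaceAdj X F G
  FaceAdj-map⁻ g {F} {G} adj =
    subst₂ (FaceAdj X) (fmap-⁻ˡ g F) (fmap-⁻ˡ g G) (FaceAdj-map (g ⁻) adj)

  triangle-map : ∀ g {a b c F} → Triangle a b c F →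
    Triangle (vmap g a) (vmap g b) (vmap g c) (fmap g F)
  triangle-map g {F = F} t = record
    { a≢b = a≢b ∘ vmap-injective g ; a≢c = a≢c ∘ vmap-injective g ; b≢c = b≢c ∘ vmap-injective g
    ; a∈F = incidence⁺ g a∈F ; b∈F = incidence⁺ g b∈F ; c∈F = incidence⁺ g c∈F
    ; only = λ {v} v∈gF →
        [ inj₁ ∘ back , [ inj₂ ∘ inj₁ ∘ back , inj₂ ∘ inj₂ ∘ back ]′ ]′
          (only (incidence⁻ g (subst (_∈ᶠ fmap g F) (sym (vmap-⁻ʳ g v)) v∈gF)))
    }
    where
    open Triangle t
    back : ∀ {v w} → vmap (g ⁻) v ≡ w → v ≡ vmap g w
    back {v} eq = trans (sym (vmap-⁻ʳ g v)) (cong (vmap g) eq)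

  -- Rigidity

  Agree : Automorphism → Automorphism → Face → Set
  Agree g h F = ∀ {v} → v ∈ᶠ F → vmap g v ≡ vmap h v

  agree⇒fmap-≡ : ∀ g h {F} → Agree g h F → fmap g F ≡ fmap h F
  agree⇒fmap-≡ g h {F} agree with a , b , c , t ← triangle F =
    Face-≡ (triangle-map g t) (move a∈F) (move b∈F) (move c∈F)
    where
    open Triangle t
    move : ∀ {v} → v ∈ᶠ F → vmap g v ∈ᶠ fmap h F
    move v∈F = subst (_∈ᶠ fmap h F) (sym (agree v∈F)) (incidence⁺ h v∈F)

  agree-on-two : ∀ g h {a b F} → a ≢ b → a ∈ᶠ F → b ∈ᶠ F → fmap g F ≡ fmap h F →
    vmap g a ≡ vmap h a → vmap g b ≡ vmap h b → Agree g h F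
  agree-on-two g h {a} {b} {F} a≢b a∈F b∈F gF≡hF ga≡ha gb≡hb {v} v∈F
    with c , t ← triangle-at₂ a≢b a∈F b∈F | Triangle.only t v∈F
  ... | inj₁ refl        = ga≡ha
  ... | inj₂ (inj₁ refl) = gb≡hb
  ... | inj₂ (inj₂ refl) = Triangle.third (triangle-map h t)
    (subst (vmap g c ∈ᶠ_) gF≡hF (incidence⁺ g (Triangle.c∈F t)))
    (λ eq → Triangle.a≢c t (vmap-injective g (trans ga≡ha (sym eq))))
    (λ eq → Triangle.b≢c t (vmap-injective g (trans gb≡hb (sym eq))))

  -- Both images of `G` lie across the same edge from the same face, hence coincide; once the ends
  -- of that edge agree, the third vertex of `G` has no choice.
  agree-step : ∀ g h {F G} → FaceAdj X F G → Agree g h F → Agree g h G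
  agree-step g h {F} {G} adj agree with b , c , x ← FaceAdj⇒Across adj =
    agree-on-two g h b≢c b∈G c∈G
      (across-unique (across-map g x)
        (subst (λ K → Across K (vmap g b) (vmap g c) (fmap h G)) (sym (agree⇒fmap-≡ g h agree))
          (subst₂ (λ b c → Across (fmap h F) b c (fmap h G))
            (sym (agree b∈F)) (sym (agree c∈F)) (across-map h x))))
      (agree b∈F) (agree c∈F)
    where open Across x

  agree-everywhere : ∀ g h {F} → Agree g h F → ∀ G → Agree g h G
  agree-everywhere g h {F} agree G = along (Graph.connected (faceGraph X) F G) agree
    where
    along : ∀ {F G} → Star (FaceAdj X) F G → Agree g h F → Agree g h G
    along ε        agree = agree
    along (a ◅ as) agree = along as (agree-step g h a agree)

  rigidᵛ : ∀ g h {F} → Agree g h F → ∀ v → vmap g v ≡ vmap h v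
  rigidᵛ g h agree v with G , v∈G ← face-at v = agree-everywhere g h agree G v∈G

  -- Vertices are determined by the faces containing them.
  fmap-≡⇒vmap-≡ : ∀ g h → (∀ F → fmap g F ≡ fmap h F) → ∀ v → vmap g v ≡ vmap h v
  fmap-≡⇒vmap-≡ g h eq v = vertex-determined λ {F} gv∈F →
    subst (vmap h v ∈ᶠ_) (trans (sym (eq (fmap (g ⁻) F))) (fmap-⁻ʳ g F))
      (incidence⁺ h (incidence⁻ g (subst (vmap g v ∈ᶠ_) (sym (fmap-⁻ʳ g F)) gv∈F)))

  vmap-≡⇒fmap-≡ : ∀ g h → (∀ v → vmap g v ≡ vmap h v) → ∀ F → fmap g F ≡ fmap h F
  vmap-≡⇒fmap-≡ g h eq F = agree⇒fmap-≡ g h λ {v} _ → eq v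

  -- Automorphisms of X, and automorphisms of its face graph

  open SurfaceAut using (faces)

  module _ (π : Vertex ↔ Vertex) {F G : Face} (m : _maps_to_ X π F G) where

    maps-∈⁺ : ∀ {v} → v ∈ᶠ F → Inverse.to π v ∈ᶠ G
    maps-∈⁺ {v} v∈F = ≼⇒∈ᶠ {_} {G} (Equivalence.to (m v) (∈ᶠ⇒≼ {v} {F} v∈F))

    maps-∈⁻ : ∀ {v} → Inverse.to π v ∈ᶠ G → v ∈ᶠ F
    maps-∈⁻ {v} πv∈G = ≼⇒∈ᶠ {v} {F} (Equivalence.from (m v) (∈ᶠ⇒≼ {_} {G} πv∈G))

  maps-to : ∀ (π : Vertex ↔ Vertex) F G →
    (∀ {v} → v ∈ᶠ F → Inverse.to π v ∈ᶠ G) → (∀ {v} → Inverse.to π v ∈ᶠ G → v ∈ᶠ F) →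
    _maps_to_ X π F G
  maps-to π F G f f⁻ v = mk⇔ {A = v ≼ F} {B = Inverse.to π v ≼ G}
    (λ v≼F → ∈ᶠ⇒≼ {_} {G} (f (≼⇒∈ᶠ {v} {F} v≼F)))
    (λ πv≼G → ∈ᶠ⇒≼ {v} {F} (f⁻ (≼⇒∈ᶠ {_} {G} πv≼G)))

  -- A `SurfaceAut` only assigns to each face some image. The assignment is injective, since the
  -- image determines the vertices of the face, and finiteness makes it a permutation.
  fromSurface : SurfaceAut X → Automorphism
  fromSurface π = record
    { vperm = SurfaceAut.perm π
    ; fperm = mk↔ₛ′ to (proj₁ ∘ onto) (proj₂ ∘ onto)
        (λ F → to-injective (proj₂ (onto (to F))))
    ; incidence⁺ = λ {_} {F} → maps-∈⁺ (SurfaceAut.perm π) (proj₂ (faces π F))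
    ; incidence⁻ = λ {_} {F} → maps-∈⁻ (SurfaceAut.perm π) (proj₂ (faces π F))
    }
    where
    to : Face → Face
    to F = proj₁ (faces π F)

    to-injective : ∀ {F G} → to F ≡ to G → F ≡ G
    to-injective {F} {G} eq with a , b , c , t ← triangle F =
      Face-≡ t (move (Triangle.a∈F t)) (move (Triangle.b∈F t)) (move (Triangle.c∈F t))
      where
      move : ∀ {v} → v ∈ᶠ F → v ∈ᶠ G
      move {v} v∈F = maps-∈⁻ (SurfaceAut.perm π) (proj₂ (faces π G))
        (subst (_ ∈ᶠ_) eq (maps-∈⁺ (SurfaceAut.perm π) (proj₂ (faces π F)) v∈F))

    onto : ∀ G → ∃[ F ] to F ≡ G
    onto = injective⇒surjective _≟ᶠ_ (proj₂ faces-finite) to to-injective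

  maps⇒fmap-≡ : ∀ g {F G} → _maps_to_ X (vperm g) F G → fmap g F ≡ G
  maps⇒fmap-≡ g {F} {G} m with a , b , c , t ← triangle F =
    Face-≡ (triangle-map g t) (maps-∈⁺ (vperm g) m (Triangle.a∈F t))
      (maps-∈⁺ (vperm g) m (Triangle.b∈F t)) (maps-∈⁺ (vperm g) m (Triangle.c∈F t))

  vperm-maps : ∀ g F → _maps_to_ X (vperm g) F (fmap g F)
  vperm-maps g F = maps-to (vperm g) F (fmap g F) (incidence⁺ g) (incidence⁻ g)

  toSurface : Automorphism → SurfaceAut X
  toSurface g = record { perm = vperm g ; faces = λ F → fmap g F , vperm-maps g F }

  toGraph : Automorphism → GraphAut (faceGraph X)
  toGraph g = record
    { perm = fperm g ; preserve = mk⇔ (FaceAdj-map g) (FaceAdj-map⁻ g) }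

  toGraph-λ-image : ∀ g → λ-image X (toGraph g)
  toGraph-λ-image g = toSurface g , vperm-maps g

  fromGraph : ∀ {φ} → λ-image X φ → Automorphism
  fromGraph {φ} (π , m) = record
    { vperm = SurfaceAut.perm π
    ; fperm = GraphAut.perm φ
    ; incidence⁺ = λ {_} {F} → maps-∈⁺ (SurfaceAut.perm π) (m F)
    ; incidence⁻ = λ {_} {F} → maps-∈⁻ (SurfaceAut.perm π) (m F)
    }

  λ-image-subgroup : IsSubgroup (autGroup (faceGraph X)) (λ-image X)
  λ-image-subgroup = record
    { resp = λ { {φ} {ψ} φ≈ψ (π , m) →
        π , λ F → subst (_maps_to_ X (SurfaceAut.perm π) F) (φ≈ψ F) (m F) }
    ; unit = toGraph-λ-image identity
    ; mult = λ {φ} {ψ} hφ hψ → toGraph-λ-image (fromGraph {φ} hφ ⊙ fromGraph {ψ} hψ)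
    ; inv  = λ {φ} hφ → toGraph-λ-image (fromGraph {φ} hφ ⁻)
    }

-- The cover by umbrellas

module _ (G : Graph) where
  open Graph G

  -- Each arc has two orientations: `swap` acts freely on the ordered pairs because no node is
  -- adjacent to itself.
  HasSize-arcs : (D : Node → Node → Set) → (∀ {x y} → D x y → Adj x y) →
    (∀ {x y} → D x y → D y x) → ∀ {n} → HasSize {Node × Node} _≡_ (λ (x , y) → D x y) n →
    ∃[ k ] 2 * k ≡ n × HasSize (_≈ᵃ_ G) (λ a → D (Arc.source a) (Arc.target a)) k
  HasSize-arcs D D⇒Adj D-sym size
    with k , 2k≡n , half ← HasSize-halve (≡-dec _≟_ _≟_) swap D-sym (λ _ → refl)
           (λ { d refl → simple (D⇒Adj d) }) size =
    k , 2k≡n , HasSize-map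
      (λ (x , y) d → arc x y (D⇒Adj d))
      (λ _ d → d)
      (Sum.map (λ (p , q) → cong₂ _,_ p q) (λ (p , q) → cong₂ _,_ p q))
      (λ a d → (Arc.source a , Arc.target a) , d ,
               λ _ _ → Sum.map (,-injective) (,-injective))
      half

  α-unfold : ∀ {k} (σ : GraphAut G) ℓ (F : Vec Node (suc k)) →
    length (deduplicate _≟_ (concatMap (λ i → map (GraphAut._·_ (_^_ G σ i)) (toList (init F))) (upTo ℓ)))
      ≡ k * ℓ →
    α G σ ℓ F ≡ concatMap (λ i → map (GraphAut._·_ (_^_ G σ (suc i))) (toList (init F))) (upTo ℓ)
  α-unfold {k} σ ℓ F eq = cong
    (λ b → if b
      then concatMap (λ i → map (GraphAut._·_ (_^_ G σ (suc i))) (toList (init F))) (upTo ℓ)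
      else [])
    (dec-true (_ ℕ.≟ _) eq)

module UmbrellaCovers (X : SimplicialSurface) where
  open SimplicialSurface X
  open Geometry X
  open Umbrellas X
  open Automorphisms X

  adjacentAt-map : ∀ g {v F G} → AdjacentAt v F G →
    AdjacentAt (vmap g v) (fmap g F) (fmap g G)
  adjacentAt-map g (_ , x) = _ , across-map g x

  Umbrella-map : ∀ g {v c} → Umbrella v c → Umbrella (vmap g v) (map (fmap g) c)
  Umbrella-map g {v} {c} u = record
    { unique   = Unique.map⁺ (fmap-injective g) (unique u)
    ; sound    = All.map⁺ (All.map (incidence⁺ g) (sound u))
    ; complete = λ {F} gv∈F → subst (_∈ map (fmap g) c) (fmap-⁻ʳ g F)
        (∈-map⁺ (fmap g) (complete u (incidence⁻ g
          (subst (vmap g v ∈ᶠ_) (sym (fmap-⁻ʳ g F)) gv∈F))))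
    ; linked   = subst (Linked _)
        (trans (List.map-++ (fmap g) c (take 1 c))
               (cong (map (fmap g) c ++_) (sym (List.take-map 1 c))))
        (Linked.map⁺ (Linked.map (adjacentAt-map g) (linked u)))
    }

  liesIn⇒∈ᶠ : ∀ a {v c} → Umbrella v c → _liesIn_ (faceGraph X) a c →
    v ∈ᶠ Arc.source a × v ∈ᶠ Arc.target a
  liesIn⇒∈ᶠ a u (_ , c∼) with p ∷ q ∷ _ ← sound (Umbrella-resp-∼ c∼ u) = p , q

  umbrella-liesIn : ∀ a {v c} → Umbrella v c → v ∈ᶠ Arc.source a → v ∈ᶠ Arc.target a →
    _liesIn_ (faceGraph X) a c
  umbrella-liesIn (arc F G adj) u v∈F v∈G =
    umbrella-through u (adjacentAt v∈F v∈G (proj₂ (proj₂ (FaceAdj⇒Across adj))))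

  module _ {C : Pred (List Face) 0ℓ}
    (C⇒umbrella : ∀ {c} → C c → ∃[ v ] Umbrella v c)
    (umbrella⇒C : ∀ {v c} → Umbrella v c → C c)
    where

    umbrellas-isCycleDoubleCover : IsCycleDoubleCover (faceGraph X) C
    umbrellas-isCycleDoubleCover = record
      { cycles = λ c Cc → cycle (proj₂ (C⇒umbrella Cc))
      ; double = double
      }
      where
      cycle : ∀ {v c} → Umbrella v c → IsCycle (faceGraph X) c
      cycle u = umbrella-length u , unique u ,
        Linked.map (λ (_ , x) → Across⇒FaceAdj x) (linked u)

      -- The two faces of an arc have exactly `b` and `c` in common, so only the umbrellas of these
      -- two vertices contain the arc.
      double : ∀ a → HasSize _∼_ (λ c → C c × _liesIn_ (faceGraph X) a c) 2
      double a@(arc F G adj) with b , c , x ← FaceAdj⇒Across adj =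
        HasSize-pair (umbrella b) (umbrella c)
          (umbrella⇒C ub , umbrella-liesIn a ub b∈F b∈G)
          (umbrella⇒C uc , umbrella-liesIn a uc c∈F c∈G)
          (λ b∼c → b≢c (umbrella-vertex-unique (Umbrella-resp-∼ b∼c ub) uc))
          λ _ (Cz , a-in-z) → which (proj₂ (C⇒umbrella Cz)) a-in-z
        where
        open Across x
        ub = umbrella-Umbrella b
        uc = umbrella-Umbrella c

        which : ∀ {v z} → Umbrella v z → _liesIn_ (faceGraph X) a z →
          z ∼ umbrella b ⊎ z ∼ umbrella c
        which u a-in-z with v∈F , v∈G ← liesIn⇒∈ᶠ a u a-in-z with across-common x v∈F v∈G
        ... | inj₁ refl = inj₁ (umbrella-unique u ub)
        ... | inj₂ refl = inj₂ (umbrella-unique u uc)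

    umbrellas-isVertexFaithful : IsVertexFaithful (faceGraph X) C
    umbrellas-isVertexFaithful = record
      { chordless = λ c Cc a s∈c t∈c → let u = proj₂ (C⇒umbrella Cc) in
          umbrella-liesIn a u (All.lookup (sound u) s∈c) (All.lookup (sound u) t∈c)
      ; atMostOne = λ c d Cc Cd c≁d a b a-c a-d b-c b-d →
          same-arc (proj₂ (C⇒umbrella Cc)) (proj₂ (C⇒umbrella Cd)) c≁d a b a-c a-d b-c b-d
      }
      where
      -- The edge joining `v` and `w` lies in just two faces, so it yields a single arc, possibly
      -- with its ends exchanged.
      same-across : ∀ {v w F G K L} → Across F v w G → Across K v w L →
        (F ≡ K × G ≡ L) ⊎ (F ≡ L × G ≡ K)
      same-across {F = F} {K = K} x y with F ≟ᶠ K
      ... | yes refl = inj₁ (refl , across-unique x y)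
      ... | no F≢K with refl ← across-unique x record
              { F≢G = F≢K ; b≢c = Across.b≢c x ; b∈F = Across.b∈F x ; c∈F = Across.c∈F x
              ; b∈G = Across.b∈F y ; c∈G = Across.c∈F y } =
        inj₂ (across-unique (across-sym x) y , refl)

      same-arc : ∀ {v w c d} → Umbrella v c → Umbrella w d → ¬ (c ∼ d) → ∀ a b →
        _liesIn_ (faceGraph X) a c → _liesIn_ (faceGraph X) a d →
        _liesIn_ (faceGraph X) b c → _liesIn_ (faceGraph X) b d →
        _≈ᵃ_ (faceGraph X) a b
      same-arc {v} {w} u u′ c≁d a b a-c a-d b-c b-d =
        same-across (shared a a-c a-d) (shared b b-c b-d)
        where
        shared : ∀ a → _liesIn_ (faceGraph X) a _ → _liesIn_ (faceGraph X) a _ →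
          Across (Arc.source a) v w (Arc.target a)
        shared a a-c a-d = record
          { F≢G = proj₁ (Arc.adjacent a)
          ; b≢c = λ { refl → c≁d (umbrella-unique u u′) }
          ; b∈F = proj₁ (liesIn⇒∈ᶠ a u a-c) ; c∈F = proj₁ (liesIn⇒∈ᶠ a u′ a-d)
          ; b∈G = proj₂ (liesIn⇒∈ᶠ a u a-c) ; c∈G = proj₂ (liesIn⇒∈ᶠ a u′ a-d) }

-- Surfaces with vf (1,2)

module FaceTransitiveSurface (X : SimplicialSurface)
  (face-transitive : FaceTransitive X) (vf : HasVF X 1 2) where
  open SimplicialSurface X
  open Geometry X
  open Umbrellas X
  open Automorphisms X
  open UmbrellaCovers X

  opaque

    moveFace : ∀ F G → ∃[ g ] fmap g F ≡ G
    moveFace F G with π , m ← face-transitive F G =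
      fromSurface π , maps⇒fmap-≡ (fromSurface π) m

    moveVertex : ∀ v w → ∃[ g ] vmap g v ≡ w
    moveVertex v w with proj₁ vf
    ... | o ∷ [] , _ , _ , _ , all with all v tt | all w tt
    ... | here (π , πv≡o) | here (ρ , ρw≡o) = fromSurface ρ ⁻ ⊙ fromSurface π ,
      trans (cong (vmap (fromSurface ρ ⁻)) (trans πv≡o (sym ρw≡o))) (vmap-⁻ˡ (fromSurface ρ) w)

  record Flip (F : Face) : Set where
    field
      τ        : Automorphism
      τF≡F     : fmap τ F ≡ F
      moves    : ¬ (∀ v → vmap τ v ≡ v)
      only-two : ∀ g → fmap g F ≡ F → (∀ v → vmap g v ≡ v) ⊎ (∀ v → vmap g v ≡ vmap τ v)

  opaque

    flip : ∀ F → Flip F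
    flip F with proj₂ vf F
    ... | π ∷ ρ ∷ [] , _ , mπ ∷ mρ ∷ [] , (π≉ρ ∷ []) ∷ [] ∷ [] , all =
      choose (all (toSurface identity) (vperm-maps identity F))
      where
      stabilizer : ∀ g → fmap g F ≡ F → Any (_≈ˢ_ X (toSurface g)) (π ∷ ρ ∷ [])
      stabilizer g gF≡F =
        all (toSurface g) (subst (_maps_to_ X (vperm g) F) gF≡F (vperm-maps g F))

      choose : Any (_≈ˢ_ X (toSurface identity)) (π ∷ ρ ∷ []) → Flip F
      choose (here id≈π) = record
        { τ = fromSurface ρ ; τF≡F = maps⇒fmap-≡ (fromSurface ρ) mρ
        ; moves = λ ρ≈id → π≉ρ λ v → trans (sym (id≈π v)) (sym (ρ≈id v))
        ; only-two = λ g gF≡F → cases g (stabilizer g gF≡F) }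
        where
        cases : ∀ g → Any (_≈ˢ_ X (toSurface g)) (π ∷ ρ ∷ []) →
          (∀ v → vmap g v ≡ v) ⊎ (∀ v → vmap g v ≡ vmap (fromSurface ρ) v)
        cases g (here g≈π)         = inj₁ λ v → trans (g≈π v) (sym (id≈π v))
        cases g (there (here g≈ρ)) = inj₂ g≈ρ
      choose (there (here id≈ρ)) = record
        { τ = fromSurface π ; τF≡F = maps⇒fmap-≡ (fromSurface π) mπ
        ; moves = λ π≈id → π≉ρ λ v → trans (π≈id v) (id≈ρ v)
        ; only-two = λ g gF≡F → cases g (stabilizer g gF≡F) }
        where
        cases : ∀ g → Any (_≈ˢ_ X (toSurface g)) (π ∷ ρ ∷ []) →
          (∀ v → vmap g v ≡ v) ⊎ (∀ v → vmap g v ≡ vmap (fromSurface π) v)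
        cases g (here g≈π)         = inj₂ g≈π
        cases g (there (here g≈ρ)) = inj₁ λ v → trans (g≈ρ v) (sym (id≈ρ v))

  -- The apex of a face

  record Apex (F : Face) (t : Automorphism) : Set where
    field
      {apex left right} : Vertex
      corners           : Triangle apex left right F
      apex-fixed        : vmap t apex ≡ apex
      left↦right        : vmap t left ≡ right

  module _ (F : Face) where
    open Flip (flip F)

    opaque

      τ-∈ : ∀ {v} → v ∈ᶠ F → vmap τ v ∈ᶠ F
      τ-∈ {v} v∈F = subst (vmap τ v ∈ᶠ_) τF≡F (incidence⁺ τ v∈F)

      τ-fixes-two : ∀ {a b} → a ≢ b → a ∈ᶠ F → b ∈ᶠ F → vmap τ a ≡ a → vmap τ b ≢ b
      τ-fixes-two a≢b a∈F b∈F τa≡a τb≡b =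
        moves (rigidᵛ τ identity (agree-on-two τ identity a≢b a∈F b∈F τF≡F τa≡a τb≡b))

      -- The square stabilises `F`, so it is the identity or `τ`; the latter would make `τ` trivial.
      τ-involutive : ∀ v → vmap τ (vmap τ v) ≡ v
      τ-involutive v with only-two (τ ⊙ τ) (trans (cong (fmap τ) τF≡F) τF≡F)
      ... | inj₁ ττ≈id = ττ≈id v
      ... | inj₂ ττ≈τ  = contradiction (vmap-injective τ ∘ ττ≈τ) moves

      fixed⇒Apex : ∀ {a b c} → Triangle a b c F → vmap τ a ≡ a → Apex F τ
      fixed⇒Apex t τa≡a = record
        { corners = t ; apex-fixed = τa≡a
        ; left↦right = third (τ-∈ b∈F)
            (λ τb≡a → a≢b (vmap-injective τ (trans τa≡a (sym τb≡a))))
            (τ-fixes-two a≢b a∈F b∈F τa≡a) }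
        where open Triangle t

      -- An involution taking `a` to `b` takes `b` back to `a`, which leaves `c` fixed.
      swapped⇒Apex : ∀ {a b c} → Triangle a b c F → vmap τ a ≡ b → Apex F τ
      swapped⇒Apex {a} {b} {c} t τa≡b = fixed⇒Apex (rotate-triangle (rotate-triangle t))
        (third (τ-∈ c∈F)
          (λ τc≡a → b≢c (trans (sym τa≡b) (trans (cong (vmap τ) (sym τc≡a)) (τ-involutive c))))
          (λ τc≡b → a≢c (vmap-injective τ (trans τa≡b (sym τc≡b)))))
        where open Triangle t

      flip-Apex : Apex F τ
      flip-Apex with a , b , c , t ← triangle F | Triangle.only t (τ-∈ (Triangle.a∈F t))
      ... | inj₁ τa≡a        = fixed⇒Apex t τa≡a
      ... | inj₂ (inj₁ τa≡b) = swapped⇒Apex t τa≡b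
      ... | inj₂ (inj₂ τa≡c) = swapped⇒Apex (swap-triangle t) τa≡c

    open Apex flip-Apex public

    opaque

      apex-∈ : apex ∈ᶠ F
      apex-∈ = Triangle.a∈F corners

      τ-fixed⇒apex : ∀ {v} → v ∈ᶠ F → vmap τ v ≡ v → v ≡ apex
      τ-fixed⇒apex {v} v∈F τv≡v with v ≟ᵛ apex
      ... | yes v≡apex = v≡apex
      ... | no  v≢apex = contradiction τv≡v
        (τ-fixes-two (v≢apex ∘ sym) apex-∈ v∈F apex-fixed)

      τ-swaps : ∀ {v w} → v ∈ᶠ F → w ∈ᶠ F → v ≢ apex → w ≢ apex → v ≢ w → vmap τ v ≡ w
      τ-swaps v∈F w∈F v≢apex w≢apex v≢w with _ , t ← triangle-at₂ (v≢apex ∘ sym) apex-∈ v∈F =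
        trans
          (Triangle.third t (τ-∈ v∈F)
            (λ τv≡apex → v≢apex (vmap-injective τ (trans τv≡apex (sym apex-fixed))))
            (λ τv≡v → v≢apex (τ-fixed⇒apex v∈F τv≡v)))
          (sym (Triangle.third t w∈F w≢apex (v≢w ∘ sym)))

      stabilizer-fixes-apex : ∀ g → fmap g F ≡ F → vmap g apex ≡ apex
      stabilizer-fixes-apex g gF≡F with only-two g gF≡F
      ... | inj₁ g≈id = g≈id apex
      ... | inj₂ g≈τ  = trans (g≈τ apex) apex-fixed

  open Flip using (τ; τF≡F; moves)

  opaque

    -- Conjugated by `g`, the flip of the image face stabilises `F` and so fixes the apex of `F`.
    -- Hence the flip itself fixes the image of that apex, and its only fixed vertex on the image
    -- face is the apex there.
    apex-map : ∀ g F → vmap g (apex F) ≡ apex (fmap g F)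
    apex-map g F = τ-fixed⇒apex G (incidence⁺ g (apex-∈ F))
      (trans (sym (vmap-⁻ʳ g _)) (cong (vmap g) (stabilizer-fixes-apex F (g ⁻ ⊙ τ (flip G) ⊙ g)
        (trans (cong (fmap (g ⁻)) (τF≡F (flip G))) (fmap-⁻ˡ g F)))))
      where
      G : Face
      G = fmap g F

    -- Face-transitivity brings `F` to `G`; if `v` lands on the wrong non-apex vertex, the flip of
    -- `G` corrects it.
    moveFlag : ∀ {v F w G} → v ∈ᶠ F → v ≢ apex F → w ∈ᶠ G → w ≢ apex G →
      ∃[ g ] fmap g F ≡ G × vmap g v ≡ w
    moveFlag {v} {F} {w} {G} v∈F v≢apex w∈G w≢apex with g , refl ← moveFace F G | vmap g v ≟ᵛ w
    ... | yes gv≡w = g , refl , gv≡w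
    ... | no  gv≢w = τ (flip (fmap g F)) ⊙ g , τF≡F (flip (fmap g F)) ,
      τ-swaps (fmap g F) (incidence⁺ g v∈F) w∈G
        (λ gv≡ → v≢apex (vmap-injective g (trans gv≡ (sym (apex-map g F))))) w≢apex gv≢w

    -- An edge of F is a leg if it contains the apex and the base otherwise; so an arc
    -- {F , G} of the face graph is a leg or a base of F according to whether apex F lies on G.

    leg-across : ∀ {F G} → FaceAdj X F G → apex F ∈ᶠ G → ∃[ x ] Across F (apex F) x G
    leg-across {F} adj apex∈G =
      adjacentAt (apex-∈ F) apex∈G (proj₂ (proj₂ (FaceAdj⇒Across adj)))

    base-across : ∀ {F G} → FaceAdj X F G → ¬ apex F ∈ᶠ G → Across F (left F) (right F) G
    base-across {F} {G} adj apex∉G with b , c , x ← FaceAdj⇒Across adj = cases b c x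
      where
      open Triangle (corners F)
      cases : ∀ b c → Across F b c G → Across F (left F) (right F) G
      cases b c x with b ≟ᵛ left F
      ... | yes refl = subst (λ c → Across F b c G)
        (third (Across.c∈F x) (λ { refl → apex∉G (Across.c∈G x) }) (Across.b≢c x ∘ sym)) x
      ... | no b≢left
        with refl ← third (Across.b∈F x) (λ { refl → apex∉G (Across.b∈G x) }) b≢left =
        subst (λ c → Across F c b G)
          (Triangle.third (swap-triangle (corners F))
            (Across.c∈F x) (λ { refl → apex∉G (Across.c∈G x) }) (Across.b≢c x ∘ sym))
          (across-swap x)

    base-unique : ∀ {F G H} → FaceAdj X F G → ¬ apex F ∈ᶠ G → FaceAdj X F H → ¬ apex F ∈ᶠ H → G ≡ H
    base-unique F-G ∉G F-H ∉H = across-unique (base-across F-G ∉G) (base-across F-H ∉H)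

    -- Both shared edges contain `v` and the apex of `F`, which are distinct, so they are the same
    -- edge.
    leg-unique : ∀ {v F G H} → v ≢ apex F → AdjacentAt v F G → AdjacentAt v F H →
      apex F ∈ᶠ G → apex F ∈ᶠ H → G ≡ H
    leg-unique {v} {F} v≢apex (_ , x) (_ , y) ∈G ∈H
      with across-common x (apex-∈ F) ∈G | across-common y (apex-∈ F) ∈H
    ... | inj₁ eq   | _         = contradiction (sym eq) v≢apex
    ... | _         | inj₁ eq   = contradiction (sym eq) v≢apex
    ... | inj₂ refl | inj₂ refl = across-unique x y

    -- A leg of `F` is determined by its non-apex end, so oriented legs correspond to the pairs that
    -- `moveFlag` moves.
    move-leg : ∀ {F x G K y L} → Across F (apex F) x G → Across K (apex K) y L →
      ∃[ g ] fmap g F ≡ K × fmap g G ≡ L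
    move-leg {F} {x} {G} {K} {y} {L} p q
      with g , refl , refl ← moveFlag (Across.c∈F p) (Across.b≢c p ∘ sym) (Across.c∈F q) (Across.b≢c q ∘ sym) =
      g , refl , across-unique (across-map g p)
        (subst (λ a → Across K a y L) (sym (apex-map g F)) q)

    -- If a base were glued to a leg then every leg would be glued to a base, and the
    -- two legs of all n faces would be 2n distinct bases, of which there are only n.
    base-sym : ∀ {F G} → FaceAdj X F G → ¬ apex F ∈ᶠ G → ¬ apex G ∈ᶠ F
    base-sym {F} {G} F-G apexF∉G apexG∈F =
      -- The left legs alone already reach every face, so the face across the right leg of `F` is
      -- `L K′` for some `K′`. Its one base leads to `K′` and to `F`, so both legs of `F` lead to
      -- the same face.
      let K′ , eq = injective⇒surjective _≟ᶠ_ (proj₂ faces-finite) (proj₁ ∘ L) L-injective (proj₁ (R F))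
          K′≡F   = base-unique
                     (Graph.symmetric (faceGraph X) (Across⇒FaceAdj (proj₂ (L K′)))) (leg⇒base (proj₂ (L K′)))
                     (subst (λ H → FaceAdj X H F) (sym eq)
                       (Graph.symmetric (faceGraph X) (Across⇒FaceAdj (proj₂ (R F)))))
                     (subst (λ H → ¬ apex H ∈ᶠ F) (sym eq) (leg⇒base (proj₂ (R F))))
          left∈  = subst (λ H → left F ∈ᶠ H) (trans (cong (proj₁ ∘ L) (sym K′≡F)) eq) (Across.c∈G (proj₂ (L F)))
      in Across.F≢G (proj₂ (R F)) (Face-≡ (corners F) (Across.b∈G (proj₂ (R F))) left∈ (Across.c∈G (proj₂ (R F))))
      where
      -- The arc from `G` to `F` is a leg of `G` and the base of `F`, and every leg is an image of
      -- it.
      leg⇒base : ∀ {K y L} → Across K (apex K) y L → ¬ apex L ∈ᶠ K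
      leg⇒base q apexL∈K
        with g , refl , refl ← move-leg (proj₂ (leg-across (Graph.symmetric (faceGraph X) F-G) apexG∈F)) q =
        apexF∉G (incidence⁻ g (subst (_∈ᶠ fmap g G) (sym (apex-map g F)) apexL∈K))

      L : ∀ K → ∃[ H ] Across K (apex K) (left K) H
      L K = across K (Triangle.a≢b (corners K)) (apex-∈ K) (Triangle.b∈F (corners K))

      R : ∀ K → ∃[ H ] Across K (apex K) (right K) H
      R K = across K (Triangle.a≢c (corners K)) (apex-∈ K) (Triangle.c∈F (corners K))

      L-injective : ∀ {K K′} → proj₁ (L K) ≡ proj₁ (L K′) → K ≡ K′
      L-injective {K} {K′} eq = base-unique
        (Graph.symmetric (faceGraph X) (Across⇒FaceAdj (proj₂ (L K)))) (leg⇒base (proj₂ (L K)))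
        (subst (λ H → FaceAdj X H K′) (sym eq)
          (Graph.symmetric (faceGraph X) (Across⇒FaceAdj (proj₂ (L K′)))))
        (subst (λ H → ¬ apex H ∈ᶠ K′) (sym eq) (leg⇒base (proj₂ (L K′))))

    leg-sym : ∀ {F G} → FaceAdj X F G → apex F ∈ᶠ G → apex G ∈ᶠ F
    leg-sym {F} {G} F-G apexF∈G with apex G ∈ᶠ? F
    ... | yes apexG∈F = apexG∈F
    ... | no  apexG∉F = contradiction apexF∈G (base-sym (Graph.symmetric (faceGraph X) F-G) apexG∉F)

    -- Otherwise the apex would be the same across every leg, so all faces at a vertex that
    -- is an apex would have it as their apex; by vertex transitivity this holds at every vertex.
    leg-flips : ∀ {F G} → FaceAdj X F G → apex F ∈ᶠ G → apex G ≢ apex F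
    leg-flips {F} {G} F-G apexF∈G apexG≡apexF =
      -- The preimage of `F` under `g` contains `apex F` and so would have it as its apex; applying
      -- `g`, the apex of `F` would be `left F`.
      let g , ga≡b = moveVertex (apex F) (left F)
          b∈gF′    = subst₂ _∈ᶠ_ (sym ga≡b) (sym (fmap-⁻ʳ g F)) (Triangle.b∈F (corners F))
      in Triangle.a≢b (corners F)
           (trans (cong apex (sym (fmap-⁻ʳ g F)))
             (trans (sym (apex-map g (fmap (g ⁻) F)))
               (trans (cong (vmap g) (all-apexes (incidence⁻ g b∈gF′))) ga≡b)))
      where
      preserved : ∀ {K L} → FaceAdj X K L → apex K ∈ᶠ L → apex L ≡ apex K
      preserved K-L apexK∈L
        with g , refl , refl ← move-leg (proj₂ (leg-across F-G apexF∈G)) (proj₂ (leg-across K-L apexK∈L)) =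
        trans (sym (apex-map g G)) (trans (cong (vmap g) apexG≡apexF) (apex-map g F))

      spread : ∀ {H Hs} → apex H ≡ apex F → Linked (AdjacentAt (apex F)) (H ∷ Hs) →
        All (λ K → apex K ≡ apex F) (H ∷ Hs)
      spread eq [-]           = eq ∷ []
      spread {H} eq (_∷_ {y = H′} (_ , x) l) = eq ∷ spread
        (trans (preserved (Across⇒FaceAdj x) (subst (_∈ᶠ H′) (sym eq) (Across.b∈G x))) eq) l

      all-apexes : ∀ {K} → apex F ∈ᶠ K → apex K ≡ apex F
      all-apexes apex∈K
        with xs , ys , eq ← ∈-∃++ (complete (umbrella-Umbrella (apex F)) (apex-∈ F)) =
        All.lookup (spread refl (Linked-++⁻ˡ (F ∷ ys ++ xs) (linked u))) (complete u apex∈K)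
        where
        u : Umbrella (apex F) (F ∷ ys ++ xs)
        u = Umbrella-resp-Rotation (xs , F ∷ ys , eq , refl) (umbrella-Umbrella (apex F))

-- The (1,2)-group of a surface with vf (1,2)

module OneTwoData (X : SimplicialSurface)
  (face-transitive : FaceTransitive X) (vf : HasVF X 1 2) where
  open SimplicialSurface X
  open Geometry X
  open Umbrellas X
  open Automorphisms X
  open UmbrellaCovers X
  open FaceTransitiveSurface X face-transitive vf
  open Flip using (τ; τF≡F; moves)

  private
    Γ : Graph
    Γ = faceGraph X

  -- Along an umbrella of v the edges through v are, cyclically, base, leg, leg: the
  -- faces come in triples F₁ F₂ F₃ of which exactly the last has its apex at v.

  opaque

    adjacent : ∀ {v F G} → AdjacentAt v F G → FaceAdj X F G
    adjacent (_ , x) = Across⇒FaceAdj x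

  v : Vertex
  v = apex some-face

  opaque

    umbrella-start : ∃[ zs ] Umbrella v (some-face ∷ zs)
    umbrella-start
      with xs , ys , eq ← ∈-∃++ (complete (umbrella-Umbrella v) (apex-∈ some-face)) =
      ys ++ xs , Umbrella-resp-Rotation (xs , some-face ∷ ys , eq , refl) (umbrella-Umbrella v)

  zs : List Face
  zs = proj₁ umbrella-start

  c₀ : List Face
  c₀ = some-face ∷ zs

  opaque

    c₀-umbrella : Umbrella v c₀
    c₀-umbrella = proj₂ umbrella-start

  d : ℕ
  d = length c₀

  s : ℕ → Face
  s = entry some-face zs

  opaque

    v∈s : ∀ n → v ∈ᶠ s n
    v∈s = entry-All some-face zs (sound c₀-umbrella)

    s-adjacent : ∀ n → AdjacentAt v (s n) (s (1 + n))
    s-adjacent = entry-Linked some-face zs (linked c₀-umbrella)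

    s-adj : ∀ n → FaceAdj X (s n) (s (1 + n))
    s-adj n = adjacent (s-adjacent n)

    s-adj⁻ : ∀ n → FaceAdj X (s (1 + n)) (s n)
    s-adj⁻ n = Graph.symmetric Γ (s-adj n)

    s-skip : ∀ n → s n ≢ s (2 + n)
    s-skip n eq = entry-distinct (unique c₀-umbrella) n 2 (s≤s z≤n)
      (ℕ.≤-pred (umbrella-length c₀-umbrella))
      (trans (cong s (ℕ.+-comm n 2)) (sym eq))

  record Period (n : ℕ) : Set where
    field
      not-apex₁ : v ≢ apex (s (1 + n))
      not-apex₂ : v ≢ apex (s (2 + n))
      base₁₂    : ¬ apex (s (1 + n)) ∈ᶠ s (2 + n)
      leg₂₃     : apex (s (2 + n)) ∈ᶠ s (3 + n)
      apex₃     : v ≡ apex (s (3 + n))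

  opaque

    period : ∀ n → v ≡ apex (s n) → Period n
    period n v≡apex = record
      { not-apex₁ = not-apex₁ ; not-apex₂ = not-apex₂ ; base₁₂ = base₁₂
      ; leg₂₃ = leg₂₃ ; apex₃ = apex₃ }
      where
      apex∈ : apex (s n) ∈ᶠ s (1 + n)
      apex∈ = subst (_∈ᶠ s (1 + n)) v≡apex (v∈s (1 + n))

      not-apex₁ : v ≢ apex (s (1 + n))
      not-apex₁ eq = leg-flips (s-adj n) apex∈ (trans (sym eq) v≡apex)

      base₁₂ : ¬ apex (s (1 + n)) ∈ᶠ s (2 + n)
      -- The face `s (1 + n)` has only one leg through `v`, and that one leads back to `s n`.
      base₁₂ = s-skip n ∘ leg-unique not-apex₁
        (adjacentAt-sym (s-adjacent n)) (s-adjacent (1 + n)) (leg-sym (s-adj n) apex∈)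

      base₂₁ : ¬ apex (s (2 + n)) ∈ᶠ s (1 + n)
      base₂₁ = base-sym (s-adj (1 + n)) base₁₂

      not-apex₂ : v ≢ apex (s (2 + n))
      not-apex₂ eq = base₂₁ (subst (_∈ᶠ s (1 + n)) eq (v∈s (1 + n)))

      leg₂₃ : apex (s (2 + n)) ∈ᶠ s (3 + n)
      leg₂₃ with apex (s (2 + n)) ∈ᶠ? s (3 + n)
      ... | yes apex∈ = apex∈
      -- The single base of `s (2 + n)` already leads back to `s (1 + n)`.
      ... | no  apex∉ = contradiction
        (base-unique (s-adj⁻ (1 + n)) base₂₁ (s-adj (2 + n)) apex∉) (s-skip (1 + n))

      apex₃ : v ≡ apex (s (3 + n))
      -- The common edge is a leg of both faces, so it contains both apexes, which differ; as `v` is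
      -- not the apex of `s (2 + n)`, it is that of `s (3 + n)`.
      apex₃ with _ , x ← s-adjacent (2 + n)
        with across-common x (apex-∈ (s (2 + n))) leg₂₃
           | across-common x (leg-sym (s-adj (2 + n)) leg₂₃) (apex-∈ (s (3 + n)))
      ... | inj₁ eq | _       = contradiction (sym eq) not-apex₂
      ... | inj₂ _  | inj₁ eq = sym eq
      ... | inj₂ p  | inj₂ q  = contradiction (trans q (sym p)) (leg-flips (s-adj (2 + n)) leg₂₃)

    apex-s : ∀ k → v ≡ apex (s (k * 3))
    apex-s zero    = refl
    apex-s (suc k) = Period.apex₃ (period (k * 3) (apex-s k))

  ℓ : ℕ
  ℓ = d / 3

  opaque

    -- A full turn returns to `s 0`, whose apex is `v`, and by `period` that is impossible at an
    -- index with remainder 1 or 2.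
    d≡3ℓ : d ≡ ℓ * 3
    d≡3ℓ = cases (d % 3) (m≡m%n+[m/n]*n d 3) (m%n<n d 3)
      where
      apex-sd : v ≡ apex (s d)
      apex-sd = cong apex (sym (trans (cong s (sym (ℕ.+-identityʳ d))) (entry-period some-face zs 0)))

      cases : ∀ r → d ≡ r + ℓ * 3 → r < 3 → d ≡ ℓ * 3
      cases 0 eq _ = eq
      cases 1 eq _ = contradiction (subst (λ n → v ≡ apex (s n)) eq apex-sd)
        (Period.not-apex₁ (period (ℓ * 3) (apex-s ℓ)))
      cases 2 eq _ = contradiction (subst (λ n → v ≡ apex (s n)) eq apex-sd)
        (Period.not-apex₂ (period (ℓ * 3) (apex-s ℓ)))
      cases (suc (suc (suc _))) _ (s≤s (s≤s (s≤s ())))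

    -- The faces `s 1` and `s 4` are one period apart, and `v` is a non-apex vertex of both.
    rotation : ∃[ g ] fmap g (s 1) ≡ s 4 × vmap g v ≡ v
    rotation = moveFlag (v∈s 1) (Period.not-apex₁ (period 0 (apex-s 0)))
                        (v∈s 4) (Period.not-apex₁ (period 3 (apex-s 1)))

  σ : Automorphism
  σ = proj₁ rotation

  opaque

    σ-s₁ : fmap σ (s 1) ≡ s 4
    σ-s₁ = proj₁ (proj₂ rotation)

    σ-v : vmap σ v ≡ v
    σ-v = proj₂ (proj₂ rotation)

    -- Two consecutive faces determine how a walk around `v` continues, so the induction carries
    -- two. At the start, `s 2` follows `s 1` because bases go to bases.
    σ-shift : ∀ n → fmap σ (s (1 + n)) ≡ s (4 + n) × fmap σ (s (2 + n)) ≡ s (5 + n)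
    σ-shift zero = σ-s₁ , base-unique
      (subst (λ F → FaceAdj X F (fmap σ (s 2))) σ-s₁ (FaceAdj-map σ (s-adj 1)))
      (λ apex∈ → Period.base₁₂ (period 0 (apex-s 0)) (incidence⁻ σ
        (subst (_∈ᶠ fmap σ (s 2)) (trans (cong apex (sym σ-s₁)) (sym (apex-map σ (s 1)))) apex∈)))
      (s-adj 4) (Period.base₁₂ (period 3 (apex-s 1)))
    σ-shift (suc n) with eq₁ , eq₂ ← σ-shift n = eq₂ , sym (degree-two
      (adjacentAt-sym (s-adjacent (4 + n)))
      (s-adjacent (5 + n))
      (subst₂ (λ w F → AdjacentAt w F (fmap σ (s (3 + n)))) σ-v eq₂
        (adjacentAt-map σ (s-adjacent (2 + n))))
      (s-skip (4 + n))
      (λ eq → s-skip (1 + n) (fmap-injective σ (trans eq₁ eq))))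

  σᴳ : GraphAut Γ
  σᴳ = toGraph σ

  opaque

    σ^-shift : ∀ k n → GraphAut._·_ (_^_ Γ σᴳ k) (s (1 + n)) ≡ s (1 + (k * 3 + n))
    σ^-shift zero    n = refl
    σ^-shift (suc k) n = trans (cong (fmap σ) (σ^-shift k n)) (proj₁ (σ-shift (k * 3 + n)))

  -- The powers taken in the graph forget the action on vertices, and `flag-rigid` needs that of
  -- `v`.
  power : ℕ → Automorphism
  power zero    = identity
  power (suc k) = σ ⊙ power k

  opaque

    fmap-power : ∀ k F → fmap (power k) F ≡ GraphAut._·_ (_^_ Γ σᴳ k) F
    fmap-power zero    F = refl
    fmap-power (suc k) F = cong (fmap σ) (fmap-power k F)

    vmap-power : ∀ k → vmap (power k) v ≡ v
    vmap-power zero    = refl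
    vmap-power (suc k) = trans (cong (vmap σ) (vmap-power k)) σ-v

    s-full-turn : s (1 + (ℓ * 3 + 0)) ≡ s 1
    s-full-turn = trans
      (cong s (trans (cong suc (ℕ.+-identityʳ (ℓ * 3))) (trans (cong suc (sym d≡3ℓ)) (ℕ.+-comm 1 d))))
      (entry-period some-face zs 1)

    -- The only non-trivial stabiliser element is the flip, and of the vertices of `F` it fixes just
    -- the apex.
    flag-rigid : ∀ g {w F} → w ∈ᶠ F → w ≢ apex F → fmap g F ≡ F → vmap g w ≡ w →
      ∀ G → fmap g G ≡ G
    flag-rigid g {F = F} w∈F w≢apex gF≡F gw≡w with Flip.only-two (flip F) g gF≡F
    ... | inj₁ g≈id = vmap-≡⇒fmap-≡ g identity g≈id
    ... | inj₂ g≈τ  = contradiction (τ-fixed⇒apex F w∈F (trans (sym (g≈τ _)) gw≡w)) w≢apex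

    -- The power `ℓ` fixes `s 1` and `v`, hence everything; a smaller positive power moves `s 1` by
    -- less than a full turn.
    σ-order : HasOrder (autGroup Γ) σᴳ ℓ
    σ-order = 0<ℓ ,
      (λ F → trans (sym (fmap-power ℓ F)) (flag-rigid (power ℓ) (v∈s 1)
        (Period.not-apex₁ (period 0 (apex-s 0)))
        (trans (fmap-power ℓ (s 1)) (trans (σ^-shift ℓ 0) s-full-turn)) (vmap-power ℓ) F)) ,
      minimal
      where
      0<ℓ : 0 < ℓ
      0<ℓ with ℓ | d≡3ℓ
      ... | suc _ | _ = s≤s z≤n

      minimal : ∀ k → 0 < k → (∀ F → GraphAut._·_ (_^_ Γ σᴳ k) F ≡ F) → ℓ ≤ k
      minimal k 0<k σ^k≈id with ℓ ≤? k
      ... | yes ℓ≤k = ℓ≤k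
      ... | no  ℓ≰k = contradiction
        (trans (cong (s ∘ suc) (sym (ℕ.+-identityʳ (k * 3)))) (trans (sym (σ^-shift k 0)) (σ^k≈id (s 1))))
        (entry-distinct (unique c₀-umbrella) 1 (k * 3) (ℕ.*-monoˡ-< 3 0<k)
          (ℕ.≤-pred (subst (k * 3 <_) (sym d≡3ℓ) (ℕ.*-monoˡ-< 3 (ℕ.≰⇒> ℓ≰k)))))

  -- The umbrella as an α-cycle

  segment : ℕ → List Face
  segment i = map (GraphAut._·_ (_^_ Γ σᴳ i)) (s 1 ∷ s 2 ∷ s 3 ∷ [])

  opaque

    segment-s : ∀ i → segment i ≡ s (1 + (i * 3 + 0)) ∷ s (1 + (i * 3 + 1)) ∷ s (1 + (i * 3 + 2)) ∷ []
    segment-s i = cong₂ _∷_ (σ^-shift i 0) (cong₂ _∷_ (σ^-shift i 1) (cong (_∷ []) (σ^-shift i 2)))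

    segments : concatMap segment (upTo ℓ) ≡ rotateBy 1 c₀
    segments = trans
      (concatMap-applyUpTo-triples segment id (s ∘ (1 +_)) ℓ segment-s)
      (trans (cong (applyUpTo (s ∘ (1 +_))) (sym d≡3ℓ)) (applyUpTo-entry-+ 1 some-face zs))

    -- The α-cycle starts with the first power of `σ`, hence a rotation by 4 instead of 1.
    segments-suc : concatMap (segment ∘ suc) (upTo ℓ) ≡ rotateBy 4 c₀
    segments-suc = trans
      (concatMap-applyUpTo-triples (segment ∘ suc) id (s ∘ (4 +_)) ℓ (segment-s ∘ suc))
      (trans (cong (applyUpTo (s ∘ (4 +_))) (sym d≡3ℓ)) (applyUpTo-entry-+ 4 some-face zs))

  F₁₂₃₄ : Vec Face 4
  F₁₂₃₄ = s 1 ∷ s 2 ∷ s 3 ∷ s 4 ∷ []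

  opaque

    -- The length test in `α` succeeds because the segments list every face of the umbrella exactly
    -- once.
    α-umbrella : Umbrella v (α Γ σᴳ ℓ F₁₂₃₄)
    α-umbrella = subst (Umbrella v)
      (sym (trans (α-unfold Γ σᴳ ℓ F₁₂₃₄ count) segments-suc))
      (Umbrella-rotateBy 4 c₀ c₀-umbrella)
      where
      count : length (deduplicate _≟ᶠ_ (concatMap segment (upTo ℓ))) ≡ 3 * ℓ
      count = trans (cong (length ∘ deduplicate _≟ᶠ_) segments)
        (trans (cong length (deduplicate-Unique _≟ᶠ_
                 (unique (Umbrella-rotateBy 1 c₀ c₀-umbrella))))
               (trans (length-rotateBy 1 c₀) (trans d≡3ℓ (ℕ.*-comm ℓ 3))))

  cover : List Face → Set
  cover = CycleOrbit Γ (λ-image X) (α Γ σᴳ ℓ F₁₂₃₄)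

  opaque

    cover⇒umbrella : ∀ {c} → cover c → ∃[ w ] Umbrella w c
    cover⇒umbrella (φ , hφ , c∼) =
      _ , Umbrella-resp-∼ c∼ (Umbrella-map (fromGraph {φ} hφ) α-umbrella)

    -- Vertex-transitivity carries the α-cycle to an umbrella of `w`, and that is unique up to
    -- rotation and reversal.
    umbrella⇒cover : ∀ {w c} → Umbrella w c → cover c
    umbrella⇒cover {w} u with g , refl ← moveVertex v w =
      toGraph g , toGraph-λ-image g , umbrella-unique (Umbrella-map g α-umbrella) u

  order : ℕ
  order = Graph.order Γ

  opaque

    card-λ-image : HasSize (Group._≈_ (autGroup Γ)) (λ-image X) (2 * order)
    card-λ-image = subst (HasSize _ (λ-image X)) (ℕ.*-comm order 2)
      (HasSize-fibres (λ φ → GraphAut._·_ φ some-face) (λ φ≈ψ → φ≈ψ some-face) (proj₂ faces-finite) fibre)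
      where
      t : Automorphism
      t = τ (flip some-face)

      fibre : ∀ G → HasSize (Group._≈_ (autGroup Γ))
        (λ φ → λ-image X φ × GraphAut._·_ φ some-face ≡ G) 2
      -- The fibre is a coset of the stabiliser: `g`, and `g` preceded by the flip.
      fibre G with g , refl ← moveFace some-face G =
        HasSize-pair (toGraph g) (toGraph (g ⊙ t))
          (toGraph-λ-image g , refl)
          (toGraph-λ-image (g ⊙ t) , cong (fmap g) (τF≡F (flip some-face)))
          (λ g≈gt → moves (flip some-face) λ w →
            vmap-injective g (sym (fmap-≡⇒vmap-≡ g (g ⊙ t) g≈gt w)))
          which
        where
        which : ∀ φ → λ-image X φ × GraphAut._·_ φ some-face ≡ fmap g some-face →
          (∀ F → GraphAut._·_ φ F ≡ fmap g F) ⊎ (∀ F → GraphAut._·_ φ F ≡ fmap g (fmap t F))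
        which φ (hφ , eq)
          with Flip.only-two (flip some-face) (g ⁻ ⊙ fromGraph {φ} hφ)
                 (trans (cong (fmap (g ⁻)) eq) (fmap-⁻ˡ g some-face))
        ... | inj₁ ≈id = inj₁ (vmap-≡⇒fmap-≡ (fromGraph {φ} hφ) g λ w →
          trans (sym (vmap-⁻ʳ g _)) (cong (vmap g) (≈id w)))
        ... | inj₂ ≈t  = inj₂ (vmap-≡⇒fmap-≡ (fromGraph {φ} hφ) (g ⊙ t) λ w →
          trans (sym (vmap-⁻ʳ g _)) (cong (vmap g) (≈t w)))

    cubic : Cubic Γ
    cubic F with a , b , c , t ← triangle F =
      K ∷ L ∷ M ∷ [] , refl ,
      Across⇒FaceAdj ab ∷ Across⇒FaceAdj bc ∷ Across⇒FaceAdj ac ∷ [] ,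
      ((λ K≡L → Across.F≢G ab (Face-≡ t (Across.b∈G ab) (Across.c∈G ab)
                  (subst (c ∈ᶠ_) (sym K≡L) (Across.c∈G bc)))) ∷
       (λ K≡M → Across.F≢G ab (Face-≡ t (Across.b∈G ab) (Across.c∈G ab)
                  (subst (c ∈ᶠ_) (sym K≡M) (Across.c∈G ac)))) ∷ []) ∷
      ((λ L≡M → Across.F≢G bc (Face-≡ t (subst (a ∈ᶠ_) (sym L≡M) (Across.b∈G ac))
                  (Across.b∈G bc) (Across.c∈G bc))) ∷ []) ∷ [] ∷ [] ,
      λ G adj → let x , y , p = FaceAdj⇒Across adj in
        complete′ p (only (Across.b∈F p)) (only (Across.c∈F p))
      where
      open Triangle t
      K L M : Face
      K = proj₁ (across F a≢b a∈F b∈F)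
      L = proj₁ (across F b≢c b∈F c∈F)
      M = proj₁ (across F a≢c a∈F c∈F)

      ab : Across F a b K
      ab = proj₂ (across F a≢b a∈F b∈F)

      bc : Across F b c L
      bc = proj₂ (across F b≢c b∈F c∈F)

      ac : Across F a c M
      ac = proj₂ (across F a≢c a∈F c∈F)

      complete′ : ∀ {x y G} → Across F x y G → x ≡ a ⊎ x ≡ b ⊎ x ≡ c → y ≡ a ⊎ y ≡ b ⊎ y ≡ c →
        Any (G ≡_) (K ∷ L ∷ M ∷ [])
      complete′ p (inj₁ refl)        (inj₁ refl)        = contradiction refl (Across.b≢c p)
      complete′ p (inj₁ refl)        (inj₂ (inj₁ refl)) = here (across-unique p ab)
      complete′ p (inj₁ refl)        (inj₂ (inj₂ refl)) = there (there (here (across-unique p ac)))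
      complete′ p (inj₂ (inj₁ refl)) (inj₁ refl)        = here (across-unique (across-swap p) ab)
      complete′ p (inj₂ (inj₁ refl)) (inj₂ (inj₁ refl)) = contradiction refl (Across.b≢c p)
      complete′ p (inj₂ (inj₁ refl)) (inj₂ (inj₂ refl)) = there (here (across-unique p bc))
      complete′ p (inj₂ (inj₂ refl)) (inj₁ refl)        =
        there (there (here (across-unique (across-swap p) ac)))
      complete′ p (inj₂ (inj₂ refl)) (inj₂ (inj₁ refl)) =
        there (here (across-unique (across-swap p) bc))
      complete′ p (inj₂ (inj₂ refl)) (inj₂ (inj₂ refl)) = contradiction refl (Across.b≢c p)

  -- The two orbits of arcs

  Leg Base : Face → Face → Set
  Leg  F G = FaceAdj X F G × apex F ∈ᶠ G
  Base F G = FaceAdj X F G × ¬ apex F ∈ᶠ G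

  opaque

    Leg-sym : ∀ {F G} → Leg F G → Leg G F
    Leg-sym (F-G , apex∈) = Graph.symmetric Γ F-G , leg-sym F-G apex∈

    Base-sym : ∀ {F G} → Base F G → Base G F
    Base-sym (F-G , apex∉) = Graph.symmetric Γ F-G , base-sym F-G apex∉

  LegArc BaseArc : Arc Γ → Set
  LegArc  a = Leg (Arc.source a) (Arc.target a)
  BaseArc a = Base (Arc.source a) (Arc.target a)

  opaque

    Leg-map : ∀ g {F G} → Leg F G → Leg (fmap g F) (fmap g G)
    Leg-map g {F} {G} (F-G , apex∈) =
      FaceAdj-map g F-G , subst (_∈ᶠ fmap g G) (apex-map g F) (incidence⁺ g apex∈)

    Base-map : ∀ g {F G} → Base F G → Base (fmap g F) (fmap g G)
    Base-map g {F} {G} (F-G , apex∉) = FaceAdj-map g F-G ,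
      λ apex∈ → apex∉ (incidence⁻ g (subst (_∈ᶠ fmap g G) (sym (apex-map g F)) apex∈))

    ≈ᵃ-resp : {D : Face → Face → Set} → (∀ {F G} → D F G → D G F) → ∀ {a b} → _≈ᵃ_ Γ a b →
      D (Arc.source a) (Arc.target a) → D (Arc.source b) (Arc.target b)
    ≈ᵃ-resp D-sym (inj₁ (refl , refl)) d = d
    ≈ᵃ-resp D-sym (inj₂ (refl , refl)) d = D-sym d

  e₁ e₂ : Arc Γ
  e₁ = arc (s 2) (s 3) (s-adj 2)
  e₂ = arc (s 1) (s 2) (s-adj 1)

  opaque

    leg-e₁ : LegArc e₁
    leg-e₁ = s-adj 2 , Period.leg₂₃ (period 0 (apex-s 0))

    base-e₂ : BaseArc e₂
    base-e₂ = s-adj 1 , Period.base₁₂ (period 0 (apex-s 0))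

    E₁⇒leg : ∀ {a} → ArcOrbit Γ (λ-image X) e₁ a → LegArc a
    E₁⇒leg {a} (φ , hφ , eq) = ≈ᵃ-resp {Leg} Leg-sym {mapArc Γ φ e₁} {a} eq
      (Leg-map (fromGraph {φ} hφ) leg-e₁)

    leg⇒E₁ : ∀ {a} → LegArc a → ArcOrbit Γ (λ-image X) e₁ a
    leg⇒E₁ {arc F G adj} (_ , apex∈)
      with g , eq₁ , eq₂ ← move-leg (proj₂ (leg-across (proj₁ leg-e₁) (proj₂ leg-e₁)))
                                    (proj₂ (leg-across adj apex∈)) =
      toGraph g , toGraph-λ-image g , inj₁ (eq₁ , eq₂)

    E₂⇒base : ∀ {a} → ArcOrbit Γ (λ-image X) e₂ a → BaseArc a
    E₂⇒base {a} (φ , hφ , eq) = ≈ᵃ-resp {Base} Base-sym {mapArc Γ φ e₂} {a} eq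
      (Base-map (fromGraph {φ} hφ) base-e₂)

    -- Moving the source suffices, since a face has only one base.
    base⇒E₂ : ∀ {a} → BaseArc a → ArcOrbit Γ (λ-image X) e₂ a
    base⇒E₂ {arc F G adj} (_ , apex∉) with g , refl ← moveFace (s 1) F
      with adj′ , apex∉′ ← Base-map g base-e₂ =
      toGraph g , toGraph-λ-image g , inj₁ (refl , base-unique adj′ apex∉′ adj apex∉)

    legs-of : ∀ F → HasSize _≡_ (λ e → Leg (proj₁ e) (proj₂ e) × proj₁ e ≡ F) 2
    legs-of F = HasSize-pair (F , K) (F , L)
      ((Across⇒FaceAdj p , Across.b∈G p) , refl)
      ((Across⇒FaceAdj q , Across.b∈G q) , refl)
      (λ eq → Across.F≢G p (Face-≡ (corners F) (Across.b∈G p) (Across.c∈G p)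
        (subst (right F ∈ᶠ_) (sym (cong proj₂ eq)) (Across.c∈G q))))
      λ { (.F , M) ((F-M , apex∈) , refl) → which (proj₂ (leg-across F-M apex∈)) }
      where
      open Triangle (corners F)

      K L : Face
      K = proj₁ (across F a≢b a∈F b∈F)
      L = proj₁ (across F a≢c a∈F c∈F)

      p : Across F (apex F) (left F) K
      p = proj₂ (across F a≢b a∈F b∈F)

      q : Across F (apex F) (right F) L
      q = proj₂ (across F a≢c a∈F c∈F)

      which : ∀ {x M} → Across F (apex F) x M → (F , M) ≡ (F , K) ⊎ (F , M) ≡ (F , L)
      which r with only (Across.c∈F r)
      ... | inj₁ refl        = contradiction refl (Across.b≢c r)
      ... | inj₂ (inj₁ refl) = inj₁ (cong (F ,_) (across-unique r p))
      ... | inj₂ (inj₂ refl) = inj₂ (cong (F ,_) (across-unique r q))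

    base-of : ∀ F → HasSize _≡_ (λ e → Base (proj₁ e) (proj₂ e) × proj₁ e ≡ F) 1
    base-of F = (F , M) ∷ [] , refl , ((F-M , apex∉) , refl) ∷ [] , [] ∷ [] ,
      λ { (.F , N) ((F-N , apex∉′) , refl) → here (cong (F ,_) (base-unique F-N apex∉′ F-M apex∉)) }
      where
      open Triangle (corners F)

      M : Face
      M = proj₁ (across F b≢c b∈F c∈F)

      p : Across F (left F) (right F) M
      p = proj₂ (across F b≢c b∈F c∈F)

      F-M : FaceAdj X F M
      F-M = Across⇒FaceAdj p

      apex∉ : ¬ apex F ∈ᶠ M
      apex∉ apex∈ = Across.F≢G p (Face-≡ (corners F) apex∈ (Across.b∈G p) (Across.c∈G p))

    -- Two legs on each face make twice `order` oriented legs, and each arc accounts for two of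
    -- them.
    card-legs : HasSize (_≈ᵃ_ Γ) LegArc order
    card-legs
      with k , 2k≡ , legs ← HasSize-arcs Γ Leg proj₁ Leg-sym
             (HasSize-fibres proj₁ (cong proj₁) (proj₂ faces-finite) legs-of) =
      subst (HasSize (_≈ᵃ_ Γ) LegArc) (ℕ.*-cancelˡ-≡ k order 2 (trans 2k≡ (ℕ.*-comm order 2))) legs

    card-bases : ∃[ k ] HasSize (_≈ᵃ_ Γ) BaseArc k × 2 * k ≡ order
    card-bases
      with k , 2k≡ , bases ← HasSize-arcs Γ Base proj₁ Base-sym
             (HasSize-fibres proj₁ (cong proj₁) (proj₂ faces-finite) base-of) =
      k , bases , trans 2k≡ (ℕ.*-identityʳ order)

    covering : ∀ a → ArcOrbit Γ (λ-image X) e₁ a ⊎ ArcOrbit Γ (λ-image X) e₂ a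
    covering a@(arc F G adj) with apex F ∈ᶠ? G
    ... | yes apex∈ = inj₁ (leg⇒E₁ {a} (adj , apex∈))
    ... | no  apex∉ = inj₂ (base⇒E₂ {a} (adj , apex∉))

    disjoint : ∀ a → ¬ (ArcOrbit Γ (λ-image X) e₁ a × ArcOrbit Γ (λ-image X) e₂ a)
    disjoint a (a∈E₁ , a∈E₂) = proj₂ (E₂⇒base {a} a∈E₂) (proj₂ (E₁⇒leg {a} a∈E₁))

    card-E₁ : HasSize (_≈ᵃ_ Γ) (ArcOrbit Γ (λ-image X) e₁) order
    card-E₁ = HasSize-⇔ (λ {a} → leg⇒E₁ {a}) (λ {a} → E₁⇒leg {a}) card-legs

    card-E₂ : ∃[ k ] HasSize (_≈ᵃ_ Γ) (ArcOrbit Γ (λ-image X) e₂) k × 2 * k ≡ order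
    card-E₂ = let k , size , eq = card-bases in
      k , HasSize-⇔ (λ {a} → base⇒E₂ {a}) (λ {a} → E₂⇒base {a}) size , eq

    transitive : NodeTransitive Γ (λ-image X)
    transitive F G = let g , eq = moveFace F G in toGraph g , toGraph-λ-image g , eq

    leg₃₄ : LegArc (arc (s 3) (s 4) (s-adj 3))
    leg₃₄ = s-adj 3 , subst (_∈ᶠ s 4) (apex-s 1) (v∈s 4)

    cover-isCycleDoubleCover : IsCycleDoubleCover Γ cover
    cover-isCycleDoubleCover = umbrellas-isCycleDoubleCover cover⇒umbrella umbrella⇒cover

    cover-isVertexFaithful : IsVertexFaithful Γ cover
    cover-isVertexFaithful = umbrellas-isVertexFaithful cover⇒umbrella umbrella⇒cover

  oneTwoGroup : OneTwoGroup Γ (λ-image X)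
  oneTwoGroup = record
    { cubic = cubic
    ; subgroup = λ-image-subgroup
    ; transitive = transitive
    ; card = card-λ-image
    ; e₁ = e₁
    ; e₂ = e₂
    ; covering = covering
    ; disjoint = disjoint
    ; card-E₁ = card-E₁
    ; card-E₂ = card-E₂
    ; F₁ = s 1 ; F₂ = s 2 ; F₃ = s 3 ; F₄ = s 4
    ; adj₁₂ = s-adj 1 ; adj₂₃ = s-adj 2 ; adj₃₄ = s-adj 3
    ; in-E₂ = base⇒E₂ {e₂} base-e₂
    ; in-E₁ = leg⇒E₁ {e₁} leg-e₁
    ; in-E₁′ = leg⇒E₁ {arc (s 3) (s 4) (s-adj 3)} leg₃₄
    ; σ = σᴳ
    ; ℓ = ℓ
    ; order-σ = σ-order
    ; σ-F₁ = σ-s₁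
    ; isCycleDoubleCover = cover-isCycleDoubleCover
    ; isVertexFaithful = cover-isVertexFaithful
    }

  cover-umbrella : ∀ w → OneTwoGroup.cover oneTwoGroup (umbrella w)
  cover-umbrella w = umbrella⇒cover (umbrella-Umbrella w)

-- Surfaces whose automorphisms form a (1,2)-group

module OneTwoGroupSurface (X : SimplicialSurface)
  (D : OneTwoGroup (faceGraph X) (λ-image X))
  (covers : ∀ v → OneTwoGroup.cover D (SimplicialSurface.umbrella X v)) where
  open SimplicialSurface X
  open Geometry X
  open Umbrellas X
  open Automorphisms X
  open UmbrellaCovers X
  open OneTwoGroup D using (transitive; card)

  private
    Γ : Graph
    Γ = faceGraph X

    open module Aut = Group (autGroup Γ) using () renaming (_≈_ to _≈ᴳ_; _∙_ to _∙ᴳ_; _⁻¹ to _⁻¹ᴳ)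

  open GraphAut using (_·_)

  face-transitive : FaceTransitive X
  face-transitive F G with φ , (π , m) , eq ← transitive F G =
    π , subst (_maps_to_ X (SurfaceAut.perm π) F) eq (m F)

  Umbrella-resp-∼⁻ : ∀ {v c d} → c ∼ d → Umbrella v d → Umbrella v c
  Umbrella-resp-∼⁻ (inj₁ (xs , ys , p , q)) u = Umbrella-resp-Rotation (ys , xs , q , p) u
  Umbrella-resp-∼⁻ {v} (inj₂ (xs , ys , p , q)) u = subst (Umbrella v) (List.reverse-involutive _)
    (Umbrella-reverse (Umbrella-resp-Rotation (ys , xs , q , p) u))

  Umbrella-map⁻ : ∀ g {v c} → Umbrella v (map (fmap g) c) → Umbrella (vmap (g ⁻) v) c
  Umbrella-map⁻ g {v} {c} u = subst (Umbrella (vmap (g ⁻) v))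
    (trans (sym (List.map-∘ c)) (trans (List.map-cong (fmap-⁻ˡ g) c) (List.map-id c)))
    (Umbrella-map (g ⁻) u)

  -- Pulled back along `g` and `h`, the umbrellas of `v` and `w` both become the α-cycle, which is
  -- the umbrella of one vertex only.
  vertex-transitive : ∀ v w → SameVertexOrbit X v w
  vertex-transitive v w with φ , hφ , c∼v ← covers v | ψ , hψ , c∼w ← covers w =
    toSurface (h ⊙ g ⁻) ,
    trans (cong (vmap h) (umbrella-vertex-unique
            (Umbrella-map⁻ g (Umbrella-resp-∼⁻ c∼v (umbrella-Umbrella v)))
            (Umbrella-map⁻ h (Umbrella-resp-∼⁻ c∼w (umbrella-Umbrella w)))))
          (vmap-⁻ʳ h w)
    where
    g h : Automorphism
    g = fromGraph {φ} hφ
    h = fromGraph {ψ} hψ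

  one-vertex-orbit : HasSize (SameVertexOrbit X) U 1
  one-vertex-orbit = v ∷ [] , refl , tt ∷ [] , [] ∷ [] , λ w _ → here (vertex-transitive w v)
    where
    v : Vertex
    v = proj₁ (triangle some-face)

  -- Orders of the face stabilisers

  Maps : Face → Face → Pred (GraphAut Γ) 0ℓ
  Maps F G φ = λ-image X φ × φ · F ≡ G

  translate : ∀ {F G n} (τ : GraphAut Γ) → λ-image X τ → τ · F ≡ G →
    HasSize _≈ᴳ_ (Maps F F) n → HasSize _≈ᴳ_ (Maps F G) n
  translate {F} τ hτ refl = HasSize-map
    (λ φ _ → τ ∙ᴳ φ)
    (λ φ (hφ , φF≡F) → mult {τ} {φ} hτ hφ , cong (τ ·_) φF≡F)
    (λ τφ≈τψ H → trans (sym (Aut.inverseˡ τ _)) (trans (cong ((τ ⁻¹ᴳ) ·_) (τφ≈τψ H)) (Aut.inverseˡ τ _)))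
    (λ ψ (hψ , ψF≡τF) → (τ ⁻¹ᴳ) ∙ᴳ ψ ,
      (mult {τ ⁻¹ᴳ} {ψ} (inv {τ} hτ) hψ , trans (cong ((τ ⁻¹ᴳ) ·_) ψF≡τF) (Aut.inverseˡ τ F)) ,
      λ φ _ τ⁻¹ψ≈φ H → trans (sym (Aut.inverseʳ τ _)) (cong (τ ·_) (τ⁻¹ψ≈φ H)))
    where open IsSubgroup λ-image-subgroup

  -- Orbit-stabiliser: the maps F ↦ G, for each of the faces G, partition the group.
  stabilizer-size : ∀ F → HasSize _≈ᴳ_ (Maps F F) 2
  stabilizer-size F
    -- Fixing `F` is decidable, so the stabiliser has some finite size `m`. The fibres give the
    -- group `order` times `m` elements, `card` gives twice `order`, and the factor cancels because
    -- `F` exists.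
    with m , stab ← HasSize-filter (λ φ → (φ · F) ≟ᶠ F) (λ φ≈ψ φF≡F → trans (sym (φ≈ψ F)) φF≡F) card =
    subst (HasSize _≈ᴳ_ (Maps F F))
      (ℕ.*-cancelˡ-≡ m 2 (Graph.order Γ) {{HasSize-nonZero {x = F} tt (proj₂ faces-finite)}}
        (trans (HasSize-unique Aut.isEquivalence
          (HasSize-fibres (_· F) (λ φ≈ψ → φ≈ψ F) (proj₂ faces-finite) λ G →
            let τ , hτ , eq = transitive F G in translate τ hτ eq stab)
          card)
          (ℕ.*-comm 2 (Graph.order Γ))))
      stab

  -- Automorphisms of `X` agree on all vertices exactly when they agree on all faces, so the count
  -- in the face graph transfers.
  stabilizer-order : ∀ F → HasSize (_≈ˢ_ X) (λ π → _maps_to_ X (SurfaceAut.perm π) F F) 2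
  stabilizer-order F = HasSize-map
    (λ φ ((π , _) , _) → π)
    (λ φ ((π , m) , eq) → subst (_maps_to_ X (SurfaceAut.perm π) F) eq (m F))
    (λ {φ} {ψ} {(hφ , _)} {(hψ , _)} → vmap-≡⇒fmap-≡ (fromGraph {φ} hφ) (fromGraph {ψ} hψ))
    (λ π m → let g = fromSurface π in
      toGraph g , (toGraph-λ-image g , maps⇒fmap-≡ g m) ,
      λ φ (hφ , _) → fmap-≡⇒vmap-≡ g (fromGraph {φ} hφ))
    (stabilizer-size F)

theorem4p14 : (X : SimplicialSurface) →
    (FaceTransitive X × HasVF X 1 2)
    ⇔ Σ (OneTwoGroup (faceGraph X) (λ-image X)) (λ D →
        ∀ v → OneTwoGroup.cover D (SimplicialSurface.umbrella X v))
theorem4p14 X = mk⇔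
  (λ (ft , vf) → OneTwoData.oneTwoGroup X ft vf , OneTwoData.cover-umbrella X ft vf)
  (λ (D , covers) →
    OneTwoGroupSurface.face-transitive X D covers ,
    OneTwoGroupSurface.one-vertex-orbit X D covers ,
    OneTwoGroupSurface.stabilizer-order X D covers)
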